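{- There exist a countable first-order signature $L$, a countable relational expansion $L^{*}$ of $L$, a Fraïssé structure $\mathbf{F}$ in $L$ and a Fraïssé precompact relational expansion $\mathbf{F}^{*}$ of $\mathbf{F}$ in $L^{*}$ such that, with $G=\mathrm{Aut}(\mathbf{F})$ and $G^{*}=\mathrm{Aut}(\mathbf{F}^{*})$, the flow $G\curvearrowright X^{*}$ on $X^{*}=\widehat{G/G^{*}}$ is universal but $\mathrm{Age}(\mathbf{F}^{*})$ does not have the Ramsey property.
   Context: $\mathbb{N}=\{0,1,2,\ldots\}$ and $[k]=\{0,\ldots,k-1\}$. $L^{*}=L\cup\{R_i : i\in I^{*}\}$, where $I^{*}$ is countable and each $R_i$ is a relation symbol not in $L$. A Fraïssé structure is a countable (infinite), locally finite (finitely generated substructures are finite), ultrahomogeneous structure (every isomorphism between finite substructures extends to an automorphism). $\mathrm{Age}(\mathbf{F})$ is the class of finite structures that embed in $\mathbf{F}$. An expansion $\mathbf{F}^{*}$ of $\mathbf{F}$ in $L^{*}$ is an $L^{*}$-structure whose $L$-reduct is $\mathbf{F}$; "Fraïssé expansion" means $\mathbf{F}^{*}$ is itself a Fraïssé structure in $L^{*}$. It is precompact if every element of $\mathrm{Age}(\mathbf{F})$ has only finitely many expansions in $\mathrm{Age}(\mathbf{F}^{*})$. Both $\mathbf{F}$ and $\mathbf{F}^{*}$ have universe $\mathbb{N}$, so $G^{*}\leq G$ are closed subgroups of $S_\infty$, the group of permutations of $\mathbb{N}$ with the topology of pointwise convergence. Let $d_L(g,h)=2^{ -m}$ with $m=\min\{n\in\mathbb{N}: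 g(n)\neq h(n)\}$ (and $d_L(g,g)=0$), and let $d_R(g,h)=d_L(g^{ -1},h^{ -1})$, a right-invariant metric on $G$. It projects to a metric on $G/G^{*}=\{gG^{*}:g\in G\}$ (the distance between two cosets is the infimum of the distances between their elements). $X^{*}=\widehat{G/G^{*}}$ is the completion of this metric space, and $G\curvearrowright X^{*}$ is the continuous action extending left multiplication on $G/G^{*}$. All topological spaces are Hausdorff. A $G$-flow is a continuous action of $G$ on a (nonempty) topological space $X$; it is compact if $X$ is compact, and minimal if every $x\in X$ has a dense orbit. A flow $G\curvearrowright X$ is universal if for every compact minimal $G$-flow $G\curvearrowright Y$ there is a continuous, surjective, $G$-equivariant map $\pi:X\to Y$. $\binom{\mathbf{B}}{\mathbf{A}}$ is the set of substructures of $\mathbf{B}$ isomorphic to $\mathbf{A}$. A class $\mathcal{C}$ of finite structures has the Ramsey property if for every $k\in\mathbb{N}$ and $\mathbf{A},\mathbf{B}\in\mathcal{C}$ there exists $\mathbf{C}\in\mathcal{C}$ such that for every $c:\binom{\mathbf{C}}{\mathbf{A}}\to[k]$ there is $\widetilde{\mathbf{B}}\in\binom{\mathbf{C}}{\mathbf{B}}$ such that $c$ takes at most one value on $\binom{\widetilde{\mathbf{B}}}{\mathbf{A}}$. -}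

module Defs where

open import Algebra.Bundles using (Group)
open import Axiom.ExcludedMiddle using (ExcludedMiddle)
open import Data.Empty using (⊥-elim)
open import Data.Fin.Base using (Fin)
open import Data.Integer.Base as ℤ using (+_)
import Data.Integer.Properties as ℤₚ
open import Data.Irrelevant as Irrelevant using (Irrelevant; [_])
open import Data.List.Base as List using (List)
import Data.List.Membership.Propositional as ListMembership
open import Data.List.Relation.Unary.Any using (Any)
open import Data.Nat.Base as ℕ using (ℕ; zero; suc; NonZero; s≤s)
import Data.Nat.Properties as ℕₚ
open import Data.Product.Base using (Σ-syntax; ∃₂; ∃-syntax; _×_; _,_; proj₁; proj₂)
open import Data.Rational.Base as ℚ using (ℚ; 0ℚ; _/_; _<_; toℚᵘ; fromℚᵘ)
import Data.Rational.Properties as ℚₚ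
open import Data.Rational.Unnormalised.Base as ℚᵘ using (mkℚᵘ; *≤*; *<*)
import Data.Rational.Unnormalised.Properties as ℚᵘₚ
open import Data.Refinement.Base using (Refinement; value; proof) renaming (_,_ to _,ʳ_)
open import Data.Sum.Base using (_⊎_; inj₁; inj₂; [_,_]′)
open import Data.Unit.Polymorphic.Base using (⊤; tt)
open import Data.Vec.Base using (Vec; []; _∷_; map)
import Data.Vec.Properties as Vecₚ
open import Data.Vec.Relation.Unary.All using (All; []; _∷_)
open import Function.Base using (id; _∘_)
open import Function.Bundles using (_↔_; _⇔_; _↣_; Inverse; Equivalence; Func; mk↔ₛ′; mk⇔)
open import Function.Definitions using (Injective)
open import Level using (Level; Setω; 0ℓ; _⊔_) renaming (suc to lsuc)
open import Relation.Binary.Bundles using (Setoid)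
import Relation.Binary.Construct.On as On
open import Relation.Binary.Definitions using (_Respects_)
open import Relation.Binary.PropositionalEquality
  using (_≡_; _≢_; refl; sym; trans; cong; subst)
import Relation.Binary.PropositionalEquality as ≡
open import Relation.Nullary.Decidable.Core using (yes; no)
open import Relation.Nullary.Negation.Core using (¬_; contradiction)
open import Relation.Unary using (Pred; _∈_; _⊆_; _∩_; _≐_; ⋃)
open import Relation.Unary.Relation.Binary.Equality using (≐-setoid)

------------------------------------------------------------------------
-- Flows range over all universe levels, so statements quantifying over
-- them live in Setω, where the library has no Σ or ×.

infix 2 Σω
record Σω {a : Level} (A : Set a) (B : A → Setω) : Setω where
  constructor _,ω_
  field
    fstω : A
    sndω : B fstω

syntax Σω A (λ x → B) = Σω[ x ∈ A ] B

infixr 2 _×ω_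
record _×ω_ {a : Level} (A : Set a) (B : Setω) : Setω where
  constructor _,ω_
  field
    fstω : A
    sndω : B

------------------------------------------------------------------------
-- First-order structures

Countable : Set → Set
Countable A = A ↣ ℕ

Finite : Set → Set
Finite A = ∃[ n ] (A ↔ Fin n)

-- Constants are function symbols of arity 0.
record Signature : Set₁ where
  field
    FunSym       : Set
    RelSym       : Set
    funArity     : FunSym → ℕ
    relArity     : RelSym → ℕ
    relArity-pos : ∀ R → NonZero (relArity R)

open Signature public

IsCountable : Signature → Set
IsCountable L = Countable (FunSym L) × Countable (RelSym L)

-- The symbols R_i, i ∈ I*, added to L to form L*.
record RelationSymbols : Set₁ where
  field
    Index     : Set
    arity     : Index → ℕ
    arity-pos : ∀ i → NonZero (arity i)

open RelationSymbols public

infixl 5 _∪ₛ_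
_∪ₛ_ : Signature → RelationSymbols → Signature
L ∪ₛ E = record
  { FunSym       = FunSym L
  ; RelSym       = RelSym L ⊎ Index E
  ; funArity     = funArity L
  ; relArity     = [ relArity L , arity E ]′
  ; relArity-pos = λ { (inj₁ R) → relArity-pos L R ; (inj₂ i) → arity-pos E i }
  }

record Structure (L : Signature) (A : Set) : Set₁ where
  field
    fun : (f : FunSym L) → Vec A (funArity L f) → A
    rel : (R : RelSym L) → Pred (Vec A (relArity L R)) 0ℓ

open Structure public

record Relations (E : RelationSymbols) (A : Set) : Set₁ where
  field
    newRel : (i : Index E) → Pred (Vec A (arity E i)) 0ℓ

open Relations public

-- The structures of the form M ⊕ X are exactly the (L ∪ₛ E)-structures
-- whose L-reduct is M.
infixl 5 _⊕_
_⊕_ : {L : Signature} {E : RelationSymbols} {A : Set} →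
      Structure L A → Relations E A → Structure (L ∪ₛ E) A
M ⊕ X = record
  { fun = fun M
  ; rel = λ { (inj₁ R) → rel M R ; (inj₂ i) → newRel X i }
  }

module _ {L : Signature} {A B : Set} (M : Structure L A) (N : Structure L B) where

  record Embedding : Set where
    field
      to        : A → B
      injective : Injective _≡_ _≡_ to
      on-fun    : ∀ f xs → to (fun M f xs) ≡ fun N f (map to xs)
      on-rel    : ∀ R xs → rel M R xs ⇔ rel N R (map to xs)

  infix 4 _≅_
  record _≅_ : Set where
    field
      bijection : A ↔ B
    open Inverse bijection public using (to; from; strictlyInverseˡ; strictlyInverseʳ)
    field
      on-fun : ∀ f xs → to (fun M f xs) ≡ fun N f (map to xs)
      on-rel : ∀ R xs → rel M R xs ⇔ rel N R (map to xs)

open Embedding public using ()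
open _≅_ public

module _ {L : Signature} {A : Set} (M : Structure L A) where

  record Substructure : Set₁ where
    field
      subset : Pred A 0ℓ
      closed : ∀ f {xs} → All subset xs → fun M f xs ∈ subset

  open Substructure

  -- Membership proofs are irrelevant, so that elements of a substructure
  -- are equal as soon as they are equal in M.
  Universe : Substructure → Set
  Universe S = Refinement A (subset S)

  private
    all-values : {P : Pred A 0ℓ} {n : ℕ} (xs : Vec (Refinement A P) n) →
                 Irrelevant (All P (map value xs))
    all-values []       = [ [] ]
    all-values (x ∷ xs) = Irrelevant.zipWith _∷_ (proof x) (all-values xs)

  ⟦_⟧ : (S : Substructure) → Structure L (Universe S)
  ⟦ S ⟧ = record
    { fun = λ f xs → fun M f (map value xs) ,ʳ Irrelevant.map (closed S f) (all-values xs)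
    ; rel = λ R xs → rel M R (map value xs)
    }

  data Generated (X : Pred A 0ℓ) : Pred A 0ℓ where
    base : ∀ {x} → x ∈ X → x ∈ Generated X
    app  : ∀ f {xs} → All (Generated X) xs → fun M f xs ∈ Generated X

  ⟨_⟩ : List A → Substructure
  ⟨ xs ⟩ = record { subset = Generated (ListMembership._∈ xs) ; closed = app }

  LocallyFinite : Set
  LocallyFinite = ∀ xs → Finite (Universe ⟨ xs ⟩)

  Ultrahomogeneous : Set₁
  Ultrahomogeneous = ∀ (S T : Substructure) → Finite (Universe S) → Finite (Universe T) →
    (φ : ⟦ S ⟧ ≅ ⟦ T ⟧) → Σ[ g ∈ M ≅ M ] (∀ s → to g (value s) ≡ value (to φ s))

open Substructure public

-- Countability and infinity are built in: the universe is ℕ.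
IsFraïssé : {L : Signature} → Structure L ℕ → Set₁
IsFraïssé F = LocallyFinite F × Ultrahomogeneous F

record FiniteStructure (L : Signature) : Set₁ where
  field
    Carrier   : Set
    finite    : Finite Carrier
    structure : Structure L Carrier

open FiniteStructure public using () renaming (Carrier to ∣_∣; structure to str)

Age : {L : Signature} {A : Set} → Structure L A → Pred (FiniteStructure L) 0ℓ
Age M A = Embedding (str A) M

_⊕ᶠ_ : {L : Signature} {E : RelationSymbols} (A : FiniteStructure L) →
       Relations E ∣ A ∣ → FiniteStructure (L ∪ₛ E)
A ⊕ᶠ X = record { finite = FiniteStructure.finite A ; structure = str A ⊕ X }

-- Equality of expansions of one and the same structure, not isomorphism.
_≈ᴿ_ : {E : RelationSymbols} {A : Set} → Relations E A → Relations E A → Set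
X ≈ᴿ Y = ∀ i xs → newRel X i xs ⇔ newRel Y i xs

Precompact : {L : Signature} {E : RelationSymbols} → Structure L ℕ → Relations E ℕ → Set₁
Precompact {L} {E} F R = ∀ (A : FiniteStructure L) → A ∈ Age F →
  ∃[ Xs ] (∀ (X : Relations E ∣ A ∣) → (A ⊕ᶠ X) ∈ Age (F ⊕ R) → Any (X ≈ᴿ_) Xs)

------------------------------------------------------------------------
-- The Ramsey property

module _ {L : Signature} where

  record Copy (B A : FiniteStructure L) : Set₁ where
    field
      substructure : Substructure (str B)
      isomorphic   : str A ≅ ⟦_⟧ (str B) substructure

  underlying : {B A : FiniteStructure L} → Copy B A → Pred ∣ B ∣ 0ℓ
  underlying S = subset (Copy.substructure S)

  -- The set of substructures of B isomorphic to A; the choice of an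
  -- isomorphism is disregarded.
  Copies : FiniteStructure L → FiniteStructure L → Setoid (lsuc 0ℓ) 0ℓ
  Copies B A = On.setoid (≐-setoid ∣ B ∣ 0ℓ) (underlying {B} {A})

  Coloring : FiniteStructure L → FiniteStructure L → ℕ → Set₁
  Coloring C A k = Func (Copies C A) (≡.setoid (Fin k))

  -- The substructures of B̃ isomorphic to A are those substructures of C
  -- isomorphic to A which are contained in B̃.
  RamseyProperty : {ℓ : Level} → Pred (FiniteStructure L) ℓ → Set (lsuc 0ℓ ⊔ ℓ)
  RamseyProperty 𝒞 = ∀ (k : ℕ) (A B : FiniteStructure L) → A ∈ 𝒞 → B ∈ 𝒞 →
    ∃[ C ] C ∈ 𝒞 × ((c : Coloring C A k) →
      Σ[ B̃ ∈ Copy C B ]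
        (∀ (S T : Copy C A) → underlying S ⊆ underlying B̃ → underlying T ⊆ underlying B̃ →
          Func.to c S ≡ Func.to c T))

------------------------------------------------------------------------
-- Topological spaces (on setoids, as the completion below is a quotient)

record TopologicalSpace (a o : Level) : Set (lsuc (a ⊔ o)) where
  field
    setoid : Setoid a a
  open Setoid setoid public
  field
    IsOpen        : Pred (Pred Carrier a) o
    open-respects : ∀ {U} → IsOpen U → U Respects _≈_
    open-≐        : ∀ {U V} → U ≐ V → IsOpen U → IsOpen V
    open-univ     : IsOpen (λ _ → ⊤)
    open-∩        : ∀ {U V} → IsOpen U → IsOpen V → IsOpen (U ∩ V)
    open-⋃        : ∀ {I : Set a} {U : I → Pred Carrier a} →
                    (∀ i → IsOpen (U i)) → IsOpen (⋃ I U)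

module _ {a o : Level} (X : TopologicalSpace a o) where
  open TopologicalSpace X

  Hausdorff : Set (lsuc a ⊔ o)
  Hausdorff = ∀ x y → ¬ (x ≈ y) →
    ∃₂ λ U V → IsOpen U × IsOpen V × x ∈ U × y ∈ V × (∀ z → z ∈ U → ¬ (z ∈ V))

  Compact : Set (lsuc a ⊔ o)
  Compact = ∀ {I : Set a} (U : I → Pred Carrier a) → (∀ i → IsOpen (U i)) →
    (∀ x → ∃[ i ] x ∈ U i) → ∃[ is ] (∀ x → Any (λ i → x ∈ U i) is)

-- Continuity is stated at every point, so that the two spaces may live
-- in different universes.
Continuous : {a o b p : Level} (X : TopologicalSpace a o) (Y : TopologicalSpace b p) →
             (TopologicalSpace.Carrier X → TopologicalSpace.Carrier Y) →
             Set (lsuc a ⊔ o ⊔ lsuc b ⊔ p)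
Continuous X Y f = ∀ x V → Y.IsOpen V → f x ∈ V →
  ∃[ U ] X.IsOpen U × x ∈ U × (∀ {z} → z ∈ U → f z ∈ V)
  where
  module X = TopologicalSpace X
  module Y = TopologicalSpace Y

------------------------------------------------------------------------
-- Automorphism groups

module _ {L : Signature} {A : Set} (M : Structure L A) where

  private
    id-iso : M ≅ M
    id-iso = record
      { bijection = mk↔ₛ′ id id (λ _ → refl) (λ _ → refl)
      ; on-fun    = λ f xs → cong (fun M f) (sym (Vecₚ.map-id xs))
      ; on-rel    = λ R xs → mk⇔ (subst (rel M R) (sym (Vecₚ.map-id xs)))
                                 (subst (rel M R) (Vecₚ.map-id xs))
      }

    comp : M ≅ M → M ≅ M → M ≅ M
    comp g h = record
      { bijection = mk↔ₛ′ (to g ∘ to h) (from h ∘ from g)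
          (λ x → trans (cong (to g) (strictlyInverseˡ h _)) (strictlyInverseˡ g x))
          (λ x → trans (cong (from h) (strictlyInverseʳ g _)) (strictlyInverseʳ h x))
      ; on-fun    = λ f xs → trans (cong (to g) (on-fun h f xs))
          (trans (on-fun g f (map (to h) xs))
                 (cong (fun M f) (sym (Vecₚ.map-∘ (to g) (to h) xs))))
      ; on-rel    = λ R xs → mk⇔
          (λ r → subst (rel M R) (sym (Vecₚ.map-∘ (to g) (to h) xs))
                   (Equivalence.to (on-rel g R _) (Equivalence.to (on-rel h R xs) r)))
          (λ r → Equivalence.from (on-rel h R xs) (Equivalence.from (on-rel g R _)
                   (subst (rel M R) (Vecₚ.map-∘ (to g) (to h) xs) r)))
      }

    map-to-from : (g : M ≅ M) {n : ℕ} (xs : Vec A n) → map (to g) (map (from g) xs) ≡ xs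
    map-to-from g xs = trans (sym (Vecₚ.map-∘ (to g) (from g) xs))
      (trans (Vecₚ.map-cong (strictlyInverseˡ g) xs) (Vecₚ.map-id xs))

    inverse : M ≅ M → M ≅ M
    inverse g = record
      { bijection = mk↔ₛ′ (from g) (to g) (strictlyInverseʳ g) (strictlyInverseˡ g)
      ; on-fun    = λ f xs → trans
          (cong (from g) (sym (trans (on-fun g f _) (cong (fun M f) (map-to-from g xs)))))
          (strictlyInverseʳ g _)
      ; on-rel    = λ R xs → mk⇔
          (λ r → Equivalence.from (on-rel g R _) (subst (rel M R) (sym (map-to-from g xs)) r))
          (λ r → subst (rel M R) (map-to-from g xs) (Equivalence.to (on-rel g R _) r))
      }

    from-cong : (g h : M ≅ M) → (∀ x → to g x ≡ to h x) → ∀ x → from g x ≡ from h x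
    from-cong g h g≈h x = trans (cong (from g) (sym (strictlyInverseˡ h x)))
      (trans (cong (from g) (sym (g≈h _))) (strictlyInverseʳ g _))

  Aut : Group 0ℓ 0ℓ
  Aut = record
    { Carrier = M ≅ M
    ; _≈_     = λ g h → ∀ x → to g x ≡ to h x
    ; _∙_     = comp
    ; ε       = id-iso
    ; _⁻¹     = inverse
    ; isGroup = record
      { isMonoid = record
        { isSemigroup = record
          { isMagma = record
            { isEquivalence = record
              { refl  = λ _ → refl
              ; sym   = λ p x → sym (p x)
              ; trans = λ p q x → trans (p x) (q x)
              }
            ; ∙-cong = λ {g} {g′} {h} {h′} p q x → trans (p _) (cong (to g′) (q x))
            }
          ; assoc = λ _ _ _ _ → refl
          }
        ; identity = (λ _ _ → refl) , (λ _ _ → refl)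
        }
      ; inverse = strictlyInverseʳ , strictlyInverseˡ
      ; ⁻¹-cong = λ {g} {h} → from-cong g h
      }
    }

-- U is a neighbourhood of g in the topology of pointwise convergence if
-- it contains all h agreeing with g on some finite set.
pointwiseTopology : {L : Signature} → Structure L ℕ → TopologicalSpace 0ℓ 0ℓ
pointwiseTopology F = record
  { setoid        = Group.setoid (Aut F)
  ; IsOpen        = λ U → ∀ g → g ∈ U → ∃[ xs ] (∀ h → Agree xs g h → h ∈ U)
  ; open-respects = λ Uo {g} {h} g≈h g∈U → proj₂ (Uo g g∈U) h (λ {x} _ → g≈h x)
  ; open-≐        = λ (U⊆V , V⊆U) Uo g g∈V →
      let xs , p = Uo g (V⊆U g∈V) in xs , λ h q → U⊆V (p h q)
  ; open-univ     = λ _ _ → List.[] , λ _ _ → tt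
  ; open-∩        = λ Uo Vo g (g∈U , g∈V) →
      let xs , p = Uo g g∈U ; ys , q = Vo g g∈V in
      xs List.++ ys , λ h r → p h (r ∘ Any.++⁺ˡ) , q h (r ∘ Any.++⁺ʳ xs)
  ; open-⋃        = λ Uo g (i , g∈U) →
      let xs , p = Uo i g g∈U in xs , λ h q → i , p h q
  }
  where
  import Data.List.Relation.Unary.Any.Properties as Any
  Agree : List ℕ → F ≅ F → F ≅ F → Set
  Agree xs g h = ∀ {x} → x ListMembership.∈ xs → to g x ≡ to h x

------------------------------------------------------------------------
-- Flows of G = Aut F

module _ {L : Signature} (F : Structure L ℕ) where
  private
    module G = Group (Aut F)
    module 𝒢 = TopologicalSpace (pointwiseTopology F)

  -- Hausdorffness is a separate condition, since for the completion of
  -- G/G* it is proved with excluded middle (completionHausdorff).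
  record Flow (a o : Level) : Set (lsuc (a ⊔ o)) where
    field
      space : TopologicalSpace a o
    open TopologicalSpace space public
    infixr 7 _·_
    field
      nonempty   : Carrier
      _·_        : G.Carrier → Carrier → Carrier
      ·-cong     : ∀ {g h x y} → g G.≈ h → x ≈ y → g · x ≈ h · y
      ·-identity : ∀ x → G.ε · x ≈ x
      ·-assoc    : ∀ g h x → (g G.∙ h) · x ≈ g · (h · x)
      -- continuity of G × X → X for the product topology
      continuous : ∀ g x U → IsOpen U → (g · x) ∈ U →
        ∃₂ λ V W → 𝒢.IsOpen V × IsOpen W × g ∈ V × x ∈ W ×
          (∀ {h y} → h ∈ V → y ∈ W → (h · y) ∈ U)

  Minimal : {a o : Level} → Flow a o → Set (lsuc a ⊔ o)
  Minimal X = ∀ x U → IsOpen U → ∃[ y ] y ∈ U → ∃[ g ] (g · x) ∈ U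
    where open Flow X

  record FactorMap {a o b p : Level} (X : Flow a o) (Y : Flow b p) :
                   Set (lsuc (a ⊔ b) ⊔ o ⊔ p) where
    private
      module X = Flow X
      module Y = Flow Y
    field
      π           : X.Carrier → Y.Carrier
      π-cong      : ∀ {x y} → x X.≈ y → π x Y.≈ π y
      continuous  : Continuous X.space Y.space π
      surjective  : ∀ y → ∃[ x ] π x Y.≈ y
      equivariant : ∀ g x → π (g X.· x) Y.≈ (g Y.· π x)

  IsUniversal : {a o : Level} → Flow a o → Setω
  IsUniversal X = ∀ {b p : Level} (Y : Flow b p) →
    Hausdorff (Flow.space Y) → Compact (Flow.space Y) → Minimal Y → FactorMap X Y

------------------------------------------------------------------------
-- Powers of 1/2

2⁻ : ℕ → ℚ
2⁻ m = _/_ (+ 1) (2 ℕ.^ m) {{ℕₚ.m^n≢0 2 m}}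

private
  unit : (k : ℕ) → ℚ
  unit k = fromℚᵘ (mkℚᵘ (+ 1) k)

  toℚᵘ-unit : ∀ k → toℚᵘ (unit k) ℚᵘ.≃ mkℚᵘ (+ 1) k
  toℚᵘ-unit k = ℚₚ.toℚᵘ-fromℚᵘ (mkℚᵘ (+ 1) k)

  unit-anti : ∀ {j k} → j ℕ.≤ k → unit k ℚ.≤ unit j
  unit-anti {j} {k} j≤k = ℚₚ.toℚᵘ-cancel-≤ {unit k} {unit j}
    (ℚᵘₚ.≤-respʳ-≃ (ℚᵘₚ.≃-sym (toℚᵘ-unit j))
      (ℚᵘₚ.≤-respˡ-≃ (ℚᵘₚ.≃-sym (toℚᵘ-unit k))
        (*≤* {mkℚᵘ (+ 1) k} {mkℚᵘ (+ 1) j}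
          (ℤₚ.*-monoˡ-≤-nonNeg (+ 1) {+ suc j} {+ suc k} (ℤ.+≤+ (s≤s j≤k))))))

  2⁻-unit : ∀ m → ∃[ k ] (suc k ≡ 2 ℕ.^ m × 2⁻ m ≡ unit k)
  2⁻-unit m = go (2 ℕ.^ m) {{ℕₚ.m^n≢0 2 m}}
    where
    go : ∀ n .{{_ : NonZero n}} → ∃[ k ] (suc k ≡ n × (+ 1) / n ≡ unit k)
    go (suc k) = k , refl , refl

  2⁻-anti : ∀ {m n} → m ℕ.≤ n → 2⁻ n ℚ.≤ 2⁻ m
  2⁻-anti {m} {n} m≤n with 2⁻-unit m | 2⁻-unit n
  ... | j , j≡ , p | k , k≡ , q rewrite p | q = unit-anti
    (ℕₚ.≤-pred (ℕₚ.≤-trans (ℕₚ.≤-reflexive j≡)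
      (ℕₚ.≤-trans (ℕₚ.^-monoʳ-≤ 2 m≤n) (ℕₚ.≤-reflexive (sym k≡)))))

  n<2^n : ∀ n → n ℕ.< 2 ℕ.^ n
  n<2^n zero    = s≤s ℕ.z≤n
  n<2^n (suc n) = ℕₚ.≤-trans (ℕₚ.+-mono-≤ (ℕₚ.m^n>0 2 n) (n<2^n n))
    (ℕₚ.≤-reflexive (cong (2 ℕ.^ n ℕ.+_) (sym (ℕₚ.+-identityʳ _))))

  2⁻-archimedean : ∀ {δ} → 0ℚ < δ → ∃[ n ] 2⁻ n < δ
  2⁻-archimedean {ℚ.mkℚ (+ zero) d c} (ℚ.*<* (ℤ.+<+ ()))
  2⁻-archimedean {ℚ.mkℚ (+ suc n) d c} _ with 2⁻-unit (suc d)
  ... | k , k≡ , p = suc d , subst (_< δ) (sym p) (ℚₚ.toℚᵘ-cancel-< {unit k} {δ}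
    (ℚᵘₚ.<-respˡ-≃ (ℚᵘₚ.≃-sym (toℚᵘ-unit k)) (*<* {mkℚᵘ (+ 1) k} {toℚᵘ δ} 1·d<n·k)))
    where
    δ = ℚ.mkℚ (+ suc n) d c
    1·d<n·k : + 1 ℤ.* + suc d ℤ.< + suc n ℤ.* + suc k
    1·d<n·k = ℤ.+<+ (ℕₚ.≤-trans (s≤s (ℕₚ.≤-reflexive (ℕₚ.*-identityˡ (suc d))))
      (ℕₚ.≤-trans (n<2^n (suc d))
        (ℕₚ.≤-trans (ℕₚ.≤-reflexive (sym k≡)) (ℕₚ.m≤m+n (suc k) _))))
  2⁻-archimedean {ℚ.mkℚ ℤ.-[1+ n ] d c} (ℚ.*<* ())

  2⁻-pos : ∀ n → 0ℚ < 2⁻ n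
  2⁻-pos n with 2⁻-unit n
  ... | k , _ , p = subst (0ℚ <_) (sym p) (ℚₚ.toℚᵘ-cancel-< {0ℚ} {unit k}
    (ℚᵘₚ.<-respʳ-≃ (ℚᵘₚ.≃-sym (toℚᵘ-unit k))
      (*<* {toℚᵘ 0ℚ} {mkℚᵘ (+ 1) k} (ℤ.+<+ (s≤s ℕ.z≤n)))))

-- The graph of the metric d_L; excluded middle makes it total.
data d-L (g h : ℕ → ℕ) : ℚ → Set where
  same   : (∀ n → g n ≡ h n) → d-L g h 0ℚ
  differ : ∀ m → g m ≢ h m → (∀ n → n ℕ.< m → g n ≡ h n) → d-L g h (2⁻ m)

private
  -- agreement on {0,…,n-1}
  Agree : ℕ → (ℕ → ℕ) → (ℕ → ℕ) → Set
  Agree n g h = ∀ i → i ℕ.< n → g i ≡ h i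

  agree⊎differ : ∀ (g h : ℕ → ℕ) n →
    Agree n g h ⊎ ∃[ m ] (m ℕ.< n × g m ≢ h m × Agree m g h)
  agree⊎differ g h zero = inj₁ λ _ ()
  agree⊎differ g h (suc n) with agree⊎differ g h n
  ... | inj₂ (m , m<n , p) = inj₂ (m , ℕₚ.m<n⇒m<1+n m<n , p)
  ... | inj₁ a with g n ℕₚ.≟ h n
  ...   | no  p = inj₂ (n , ℕₚ.≤-refl , p , a)
  ...   | yes p = inj₁ λ i i<1+n → extend i (ℕₚ.m<1+n⇒m<n∨m≡n i<1+n)
    where
    extend : ∀ i → i ℕ.< n ⊎ i ≡ n → g i ≡ h i
    extend i (inj₁ i<n)  = a i i<n
    extend i (inj₂ refl) = p

  agree⇒d-L< : ∀ {g h n δ} → 2⁻ n < δ → Agree n g h → ∀ q → d-L g h q → q < δ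
  agree⇒d-L< {n = n} n<δ a _ (same _) = ℚₚ.<-trans (2⁻-pos n) n<δ
  agree⇒d-L< {n = n} n<δ a _ (differ m p _) with m ℕₚ.<? n
  ... | yes m<n = contradiction (a m m<n) p
  ... | no  m≮n = ℚₚ.≤-<-trans (2⁻-anti (ℕₚ.≮⇒≥ m≮n)) n<δ

  d-L<⇒agree : ∀ {g h n δ} → δ ℚ.≤ 2⁻ n → (∀ q → d-L g h q → q < δ) → Agree n g h
  d-L<⇒agree {g} {h} {n} δ≤n d with agree⊎differ g h n
  ... | inj₁ a = a
  ... | inj₂ (m , m<n , p , q) = ⊥-elim (ℚₚ.<-irrefl refl
    (ℚₚ.<-≤-trans (d _ (differ m p q)) (ℚₚ.≤-trans δ≤n (2⁻-anti (ℕₚ.<⇒≤ m<n)))))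

  bound : (ℕ → ℕ) → ℕ → ℕ
  bound f zero    = 0
  bound f (suc n) = suc (f n) ℕ.⊔ bound f n

  bound-spec : ∀ f n i → i ℕ.< n → f i ℕ.< bound f n
  bound-spec f (suc n) i i<1+n with ℕₚ.m<1+n⇒m<n∨m≡n i<1+n
  ... | inj₁ i<n  = ℕₚ.≤-trans (bound-spec f n i i<n) (ℕₚ.m≤n⊔m (suc (f n)) _)
  ... | inj₂ refl = ℕₚ.m≤m⊔n (suc (f n)) (bound f n)

------------------------------------------------------------------------
-- The flow of G = Aut F on the completion of G/G*

module _ {L : Signature} {E : RelationSymbols} (F : Structure L ℕ) (R : Relations E ℕ) where
  private
    module G = Group (Aut F)
    module G* = Group (Aut (F ⊕ R))

  inclusion : G*.Carrier → G.Carrier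
  inclusion k = record
    { bijection = bijection k
    ; on-fun    = on-fun k
    ; on-rel    = λ S → on-rel k (inj₁ S)
    }

  d-R : G.Carrier → G.Carrier → ℚ → Set
  d-R g h = d-L (to (g G.⁻¹)) (to (h G.⁻¹))

  -- Since the reals are not available, the metrics derived from d_R are
  -- given by the relation "the distance is smaller than δ".
  d-R<_ : ℚ → G.Carrier → G.Carrier → Set
  (d-R< δ) g h = ∀ q → d-R g h q → q < δ

  -- The coset gG* is represented by g.  An infimum is smaller than δ iff
  -- one of the numbers it is taken over is.
  d-coset<_ : ℚ → G.Carrier → G.Carrier → Set
  (d-coset< δ) g h = ∃₂ λ k l → (d-R< δ) (g G.∙ inclusion k) (h G.∙ inclusion l)

  record CauchySequence : Set where
    field
      term   : ℕ → G.Carrier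
      cauchy : ∀ δ → 0ℚ < δ → ∃[ N ] (∀ i j → N ℕ.≤ i → N ℕ.≤ j → (d-coset< δ) (term i) (term j))

  open CauchySequence

  -- The distance in the completion is the limit of the distances of the
  -- terms; it is smaller than δ iff these are eventually bounded by
  -- some η < δ.
  d-completion<_ : ℚ → CauchySequence → CauchySequence → Set
  (d-completion< δ) x y =
    ∃[ η ] η < δ × ∃[ N ] (∀ i → N ℕ.≤ i → (d-coset< η) (term x i) (term y i))

  -- being at distance 0
  infix 4 _≈_
  _≈_ : CauchySequence → CauchySequence → Set
  x ≈ y = ∀ δ → 0ℚ < δ → (d-completion< δ) x y

  MetricOpen : Pred (Pred CauchySequence 0ℓ) 0ℓ
  MetricOpen U = ∀ x → x ∈ U → ∃[ δ ] 0ℚ < δ × (∀ y → (d-completion< δ) x y → y ∈ U)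

  private
    Near : ℕ → G.Carrier → G.Carrier → Set
    Near n g h = ∃₂ λ k l → Agree n (from (g G.∙ inclusion k)) (from (h G.∙ inclusion l))

    Close : ℕ → CauchySequence → CauchySequence → Set
    Close n x y = ∃[ N ] (∀ i → N ℕ.≤ i → Near n (term x i) (term y i))

    near⇒d-coset< : ∀ g h {n δ} → 2⁻ n < δ → Near n g h → (d-coset< δ) g h
    near⇒d-coset< g h n<δ (k , l , a) = k , l , agree⇒d-L< n<δ a

    d-coset<⇒near : ∀ g h {n δ} → δ ℚ.≤ 2⁻ n → (d-coset< δ) g h → Near n g h
    d-coset<⇒near g h δ≤n (k , l , d) = k , l , d-L<⇒agree δ≤n d

    close⇒d< : ∀ x y {n δ} → 2⁻ n < δ → Close n x y → (d-completion< δ) x y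
    close⇒d< x y n<δ (N , p) = let η , n<η , η<δ = ℚₚ.<-dense n<δ in
      η , η<δ , N , λ i N≤i → near⇒d-coset< (term x i) (term y i) n<η (p i N≤i)

    d<⇒close : ∀ x y n → (d-completion< 2⁻ n) x y → Close n x y
    d<⇒close x y n (η , η<δ , N , p) =
      N , λ i N≤i → d-coset<⇒near (term x i) (term y i) (ℚₚ.<⇒≤ η<δ) (p i N≤i)

    near-refl : ∀ {n} g → Near n g g
    near-refl g = G*.ε , G*.ε , λ _ _ → refl

    near-sym : ∀ {n} g h → Near n g h → Near n h g
    near-sym g h (k , l , a) = l , k , λ i i<n → sym (a i i<n)

    near-trans : ∀ {n} g h m → Near n g h → Near n h m → Near n g m
    near-trans g h m (k , l , a) (k′ , l′ , b) = k G*.∙ ((l G*.⁻¹) G*.∙ k′) , l′ , λ i i<n →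
      trans (cong (from k′) (trans (cong (to l) (a i i<n)) (strictlyInverseˡ l _))) (b i i<n)

    -- left multiplication on cosets is jointly continuous, uniformly in
    -- the second argument
    near-∙ : ∀ {n} g h x y → Agree n (from g) (from h) → Near (bound (from g) n) x y →
             Near n (g G.∙ x) (h G.∙ y)
    near-∙ {n} g h x y a (k , l , b) = k , l , λ i i<n →
      trans (b (from g i) (bound-spec (from g) n i i<n))
            (cong (from l ∘ from y) (a i i<n))

    close-refl : ∀ {n} x → Close n x x
    close-refl x = 0 , λ i _ → near-refl (term x i)

    close-sym : ∀ {n} x y → Close n x y → Close n y x
    close-sym x y (N , p) = N , λ i N≤i → near-sym (term x i) (term y i) (p i N≤i)

    close-trans : ∀ {n} x y z → Close n x y → Close n y z → Close n x z
    close-trans x y z (N , p) (M , q) = N ℕ.⊔ M , λ i N⊔M≤i →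
      near-trans (term x i) (term y i) (term z i)
        (p i (ℕₚ.m⊔n≤o⇒m≤o N M N⊔M≤i)) (q i (ℕₚ.m⊔n≤o⇒n≤o N M N⊔M≤i))

    close-cauchy : ∀ x n → ∃[ N ] (∀ i j → N ℕ.≤ i → N ℕ.≤ j → Near n (term x i) (term x j))
    close-cauchy x n = let N , p = cauchy x (2⁻ n) (2⁻-pos n) in
      N , λ i j N≤i N≤j → d-coset<⇒near (term x i) (term x j) ℚₚ.≤-refl (p i j N≤i N≤j)

    ≈⇒close : ∀ x y → x ≈ y → ∀ n → Close n x y
    ≈⇒close x y x≈y n = d<⇒close x y n (x≈y (2⁻ n) (2⁻-pos n))

    close⇒≈ : ∀ x y → (∀ n → Close n x y) → x ≈ y
    close⇒≈ x y c δ 0<δ = let n , n<δ = 2⁻-archimedean 0<δ in close⇒d< x y n<δ (c n)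

    d<-mono : ∀ x y {δ δ′} → δ ℚ.≤ δ′ → (d-completion< δ) x y → (d-completion< δ′) x y
    d<-mono x y δ≤δ′ (η , η<δ , p) = η , ℚₚ.<-≤-trans η<δ δ≤δ′ , p

  completionSpace : TopologicalSpace 0ℓ 0ℓ
  completionSpace = record
    { setoid = record
      { Carrier       = CauchySequence
      ; _≈_           = _≈_
      ; isEquivalence = record
        { refl  = λ {x} → close⇒≈ x x λ n → close-refl x
        ; sym   = λ {x} {y} p → close⇒≈ y x λ n → close-sym x y (≈⇒close x y p n)
        ; trans = λ {x} {y} {z} p q → close⇒≈ x z λ n →
            close-trans x y z (≈⇒close x y p n) (≈⇒close y z q n)
        }
      }
    ; IsOpen        = MetricOpen
    ; open-respects = λ {U} Uo {x} {y} x≈y x∈U →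
        let δ , 0<δ , p = Uo x x∈U in p y (x≈y δ 0<δ)
    ; open-≐        = λ (U⊆V , V⊆U) Uo x x∈V →
        let δ , 0<δ , p = Uo x (V⊆U x∈V) in δ , 0<δ , λ y d → U⊆V (p y d)
    ; open-univ     = λ _ _ → ℚ.1ℚ , ℚₚ.positive⁻¹ ℚ.1ℚ , λ _ _ → tt
    ; open-∩        = λ {U} {V} → ∩-open {U} {V}
    ; open-⋃        = λ Uo x (i , x∈U) →
        let δ , 0<δ , p = Uo i x x∈U in δ , 0<δ , λ y d → i , p y d
    }
    where
    ∩-open : ∀ {U V} → MetricOpen U → MetricOpen V → MetricOpen (U ∩ V)
    ∩-open Uo Vo x (x∈U , x∈V) with Uo x x∈U | Vo x x∈V
    ... | δ , 0<δ , p | δ′ , 0<δ′ , q with ℚₚ.≤-total δ δ′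
    ...   | inj₁ δ≤δ′ = δ , 0<δ , λ y d → p y d , q y (d<-mono x y δ≤δ′ d)
    ...   | inj₂ δ′≤δ = δ′ , 0<δ′ , λ y d → p y (d<-mono x y δ′≤δ d) , q y d

  private
    module X = TopologicalSpace completionSpace

    ball-open : ∀ x n → X.IsOpen (Close n x)
    ball-open x n y c = 2⁻ n , 2⁻-pos n , λ z d → close-trans x y z c (d<⇒close y z n d)

    translate : G.Carrier → CauchySequence → CauchySequence
    translate g x = record
      { term   = λ i → g G.∙ term x i
      ; cauchy = λ δ 0<δ →
          let n , n<δ = 2⁻-archimedean 0<δ
              N , p = close-cauchy x (bound (from g) n) in
          N , λ i j N≤i N≤j → near⇒d-coset< (g G.∙ term x i) (g G.∙ term x j) n<δ
            (near-∙ {n} g g (term x i) (term x j) (λ _ _ → refl) (p i j N≤i N≤j))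
      }

    close-translate : ∀ {n} g h x y → Agree n (from g) (from h) →
      Close (bound (from g) n) x y → Close n (translate g x) (translate h y)
    close-translate g h x y a (N , p) = N , λ i N≤i →
      near-∙ g h (term x i) (term y i) a (p i N≤i)

    -- a pointwise neighbourhood of g on which inverses agree below n
    AgreeInv : ℕ → G.Carrier → Pred G.Carrier 0ℓ
    AgreeInv n g h = Agree n (from g) (from h)

    agreeInv-open : ∀ n g → TopologicalSpace.IsOpen (pointwiseTopology F) (AgreeInv n g)
    agreeInv-open n g h a = List.map (from h) (List.upTo n) , λ h′ p i i<n →
      trans (a i i<n) (trans (sym (strictlyInverseʳ h′ _))
        (cong (from h′) (trans (sym (p (∈-map⁺ (from h) (∈-upTo⁺ i<n)))) (strictlyInverseˡ h i))))
      where open import Data.List.Membership.Propositional.Properties using (∈-map⁺; ∈-upTo⁺)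

  -- The action is the continuous extension of g · hG* = (gh)G*.
  completionFlow : Flow F 0ℓ 0ℓ
  completionFlow = record
    { space      = completionSpace
    ; nonempty   = record
      { term   = λ _ → G.ε
      ; cauchy = λ δ 0<δ → let n , n<δ = 2⁻-archimedean 0<δ in
          0 , λ i j _ _ → near⇒d-coset< G.ε G.ε n<δ (near-refl {n} G.ε)
      }
    ; _·_        = translate
    ; ·-cong     = λ {g} {h} {x} {y} g≈h x≈y → close⇒≈ (translate g x) (translate h y) λ n →
        close-translate g h x y (λ i _ → G.⁻¹-cong {g} {h} g≈h i)
          (≈⇒close x y x≈y (bound (from g) n))
    ; ·-identity = λ x → close⇒≈ (translate G.ε x) x λ n → close-refl x
    ; ·-assoc    = λ g h x → close⇒≈ (translate (g G.∙ h) x) (translate g (translate h x))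
        λ n → close-refl (translate (g G.∙ h) x)
    ; continuous = λ g x U Uo gx∈U →
        let δ , 0<δ , p = Uo (translate g x) gx∈U
            n , n<δ = 2⁻-archimedean 0<δ in
        AgreeInv n g , Close (bound (from g) n) x , agreeInv-open n g ,
        ball-open x (bound (from g) n) , (λ _ _ → refl) , close-refl x ,
        λ {h} {y} a c → p (translate h y)
          (close⇒d< (translate g x) (translate h y) n<δ (close-translate g h x y a c))
    }

  completionHausdorff : ExcludedMiddle 0ℓ → Hausdorff completionSpace
  completionHausdorff em x y x≉y with em {∃[ n ] ¬ Close n x y}
  ... | yes (n , ¬c) = Close n x , Close n y , ball-open x n , ball-open y n ,
    close-refl x , close-refl y ,
    λ z c c′ → ¬c (close-trans x z y c (close-sym y z c′))
  ... | no ∄n = contradiction (close⇒≈ x y close) x≉y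
    where
    close : ∀ n → Close n x y
    close n with em {Close n x y}
    ... | yes c = c
    ... | no ¬c = contradiction (n , ¬c) ∄n

{-# OPTIONS --safe #-}
module Submission where

-- The structure F is the linear order of the rationals, and F* adds an
-- equivalence relation with two dense classes.
--
-- The automorphism group G of the rationals is extremely amenable: every
-- compact Hausdorff G-flow has a fixed point (fixedPoint).  A minimal one is
-- therefore a single point (minimal⇒trivial), and the constant map from X*,
-- or from any other flow, onto it is a factor map.  So X* is universal for a
-- trivial reason, whatever the expansion F* is.
--
-- On the other hand the age of F* is not Ramsey: colour the points of a
-- structure embedded in F* by their classes.  Both colours occur in every copy
-- of a pair of inequivalent points, so no such copy is homogeneous for the
-- colouring of its one-point substructures (expansion-notRamsey).
--
-- Extreme amenability is proved by the argument of Kechris, Pestov and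
-- Todorcevic.  If no point is fixed, compactness gives finitely many open sets
-- covering the flow, each taken off itself by some group element and each
-- stable, up to a slight enlargement, under the pointwise stabiliser of a
-- finite set of rationals.  Via an orbit, the cover becomes a finite colouring
-- of the copies of that finite set, and Ramsey's theorem (ramsey-copies) finds
-- a point of the orbit and its translate in the same open set,
-- a contradiction.
--
-- Ultrahomogeneity of F and of F* is one back-and-forth argument
-- (BackAndForth), applied with two different conditions on the colours of
-- points and their images.  Precompactness holds as the expansions of a finite
-- order in the age of F* are given by its partitions into at most two classes.

open import Defs
open import Algebra.Bundles using (Group)
open import Axiom.ExcludedMiddle using (ExcludedMiddle)
open import Data.Bool.Base using (Bool; true; false; not; _xor_)
open import Data.Bool.Properties using (not-involutive; ¬-not) renaming (_≟_ to _≟ᵇ_)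
open import Data.Empty using (⊥; ⊥-elim)
open import Data.Fin.Base using (Fin; zero; suc; finToFun; funToFin)
open import Data.Fin.Properties using (1↔⊤; 2↔Bool; finToFun-funToFin)
open import Data.Irrelevant as Irrelevant using (Irrelevant; [_])
open import Data.List.Base as List using (List; []; _∷_; _++_; concatMap)
import Data.List.Membership.DecPropositional as DecMembership
open import Data.List.Membership.Propositional using (_∈_; find; lose)
open import Data.List.Membership.Propositional.Properties
  using (∈-map⁺; ∈-map⁻; ∈-filter⁺; ∈-filter⁻; ∈-lookup; ∈-allFin; ∈-++⁺ˡ; ∈-++⁺ʳ;
         ∈-concatMap⁺; ∈-deduplicate⁺; ∈-deduplicate⁻)
import Data.List.Properties as Listₚ
open import Data.List.Relation.Binary.Subset.Propositional using () renaming (_⊆_ to _⊆ₗ_)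
open import Data.List.Relation.Unary.All as All using (All; []; _∷_)
import Data.List.Relation.Unary.All.Properties as Allₚ
open import Data.List.Relation.Unary.AllPairs as AllPairs using (AllPairs; []; _∷_)
import Data.List.Relation.Unary.AllPairs.Properties as AllPairsₚ
open import Data.List.Relation.Unary.Any as Any using (Any; here; there; any?)
import Data.List.Relation.Unary.Any.Properties as Anyₚ
open import Data.List.Relation.Unary.Unique.DecPropositional.Properties using (deduplicate-!)
open import Data.List.Relation.Unary.Unique.Propositional using (Unique)
open import Data.Nat.Base as ℕ using (ℕ; zero; suc; _<_; _≤_; _^_)
open import Data.Nat.Binary.Base using (ℕᵇ; zero; 2[1+_]; 1+[2_]; toℕ; fromℕ)
open import Data.Nat.Binary.Properties using (fromℕ-toℕ; fromℕ-injective)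
import Data.Nat.Properties as ℕₚ
open import Data.Product.Base using (Σ-syntax; ∃-syntax; _×_; _,_; proj₁; proj₂; swap)
open import Data.Refinement.Base using (value; proof) renaming (_,_ to _,ʳ_)
open import Data.Sum.Base using (inj₁; inj₂)
open import Data.Unit.Base using (⊤; tt)
import Data.Unit.Polymorphic.Base as Polymorphic
open import Data.Vec.Base using ([]; _∷_; map)
open import Function.Base using (id; _∘_; flip)
open import Function.Bundles
  using (Func; _↔_; _⇔_; mk⇔; mk↔ₛ′; mk↣; Equivalence; Inverse)
open import Function.Construct.Identity using (⇔-id)
open import Function.Properties.Inverse using (↔-sym)
open import Level using (Level; 0ℓ; _⊔_) renaming (suc to lsuc)
open import Relation.Binary.Core using (Rel)
open import Relation.Binary.Definitions
  using (Asymmetric; Decidable; Transitive; Trichotomous; tri<; tri≈; tri>)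
open import Relation.Binary.PropositionalEquality
  using (_≡_; _≢_; refl; sym; trans; cong; subst)
open import Relation.Nullary.Decidable.Core using (Dec; yes; no; recompute)
open import Relation.Nullary.Negation.Core using (¬_; contradiction)
open import Relation.Unary using (Pred; _⊆_; _∩_)

------------------------------------------------------------------------
-- A dense linear order with two dense colours

-- A word in the letters 2[1+_] ("left") and 1+[2_] ("right"), read from the
-- outside in, is a node of the infinite binary tree, and _≺_ is the in-order
-- traversal of the tree: left subtree, root, right subtree.
infix 4 _≺_
data _≺_ : Rel ℕᵇ 0ℓ where
  left-root  : ∀ {u} → 2[1+ u ] ≺ zero
  root-right : ∀ {v} → zero ≺ 1+[2 v ]
  left-right : ∀ {u v} → 2[1+ u ] ≺ 1+[2 v ]
  left       : ∀ {u v} → u ≺ v → 2[1+ u ] ≺ 2[1+ v ]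
  right      : ∀ {u v} → u ≺ v → 1+[2 u ] ≺ 1+[2 v ]

≺-trans : Transitive _≺_
≺-trans left-root  root-right = left-right
≺-trans left-right (right _)  = left-right
≺-trans (left _)   left-root  = left-root
≺-trans (left _)   left-right = left-right
≺-trans (left p)   (left q)   = left (≺-trans p q)
≺-trans root-right (right _)  = root-right
≺-trans (right p)  (right q)  = right (≺-trans p q)

≺-irrefl : ∀ {u} → ¬ u ≺ u
≺-irrefl (left p)  = ≺-irrefl p
≺-irrefl (right p) = ≺-irrefl p

-- The outcome of a comparison, without the negative information of Tri.
data Comparison (u v : ℕᵇ) : Set where
  before : u ≺ v → Comparison u v
  equal  : u ≡ v → Comparison u v
  after  : v ≺ u → Comparison u v

≺-compare : ∀ u v → Comparison u v
≺-compare zero     zero     = equal refl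
≺-compare zero     2[1+ v ] = after left-root
≺-compare zero     1+[2 v ] = before root-right
≺-compare 2[1+ u ] zero     = before left-root
≺-compare 2[1+ u ] 1+[2 v ] = before left-right
≺-compare 1+[2 u ] zero     = after root-right
≺-compare 1+[2 u ] 2[1+ v ] = after left-right
≺-compare 2[1+ u ] 2[1+ v ] with ≺-compare u v
... | before p = before (left p)
... | equal p  = equal (cong 2[1+_] p)
... | after p  = after (left p)
≺-compare 1+[2 u ] 1+[2 v ] with ≺-compare u v
... | before p = before (right p)
... | equal p  = equal (cong 1+[2_] p)
... | after p  = after (right p)

-- The parity of the length of a word.  Every interval of the order contains
-- whole subtrees, hence words of both parities.
parity : ℕᵇ → Bool
parity zero     = false
parity 2[1+ u ] = not (parity u)
parity 1+[2 u ] = not (parity u)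

not-flip : ∀ {x b} → x ≡ not b → not x ≡ b
not-flip {b = b} refl = not-involutive b

above : ∀ u b → ∃[ w ] u ≺ w × parity w ≡ b
above zero false     = 1+[2 1+[2 zero ] ] , root-right , refl
above zero true      = 1+[2 zero ] , root-right , refl
above 2[1+ u ] b with above u (not b)
... | w , u≺w , p    = 2[1+ w ] , left u≺w , not-flip p
above 1+[2 u ] b with above u (not b)
... | w , u≺w , p    = 1+[2 w ] , right u≺w , not-flip p

below : ∀ u b → ∃[ w ] w ≺ u × parity w ≡ b
below zero false     = 2[1+ 2[1+ zero ] ] , left-root , refl
below zero true      = 2[1+ zero ] , left-root , refl
below 2[1+ u ] b with below u (not b)
... | w , w≺u , p    = 2[1+ w ] , left w≺u , not-flip p
below 1+[2 u ] b with below u (not b)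
... | w , w≺u , p    = 1+[2 w ] , right w≺u , not-flip p

between : ∀ {u v} → u ≺ v → ∀ b → ∃[ w ] u ≺ w × w ≺ v × parity w ≡ b
between {2[1+ u ]} left-root b with above u (not b)
... | w , u≺w , p       = 2[1+ w ] , left u≺w , left-root , not-flip p
between {v = 1+[2 v ]} root-right b with below v (not b)
... | w , w≺v , p       = 1+[2 w ] , root-right , right w≺v , not-flip p
between {2[1+ u ]} left-right b with above u (not b)
... | w , u≺w , p       = 2[1+ w ] , left u≺w , left-right , not-flip p
between (left u≺v) b with between u≺v (not b)
... | w , u≺w , w≺v , p = 2[1+ w ] , left u≺w , left w≺v , not-flip p
between (right u≺v) b with between u≺v (not b)
... | w , u≺w , w≺v , p = 1+[2 w ] , right u≺w , right w≺v , not-flip p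

-- The order of the words, carried over to ℕ along the binary notation.
infix 4 _⊲_ _⊲?_
record _⊲_ (x y : ℕ) : Set where
  constructor by-words
  field
    words : fromℕ x ≺ fromℕ y

-- Both colour classes are dense for _⊲_.
colour : ℕ → Bool
colour x = parity (fromℕ x)

⊲-trans : Transitive _⊲_
⊲-trans (by-words p) (by-words q) = by-words (≺-trans p q)

⊲-irrefl : ∀ {x} → ¬ x ⊲ x
⊲-irrefl (by-words p) = ≺-irrefl p

⊲-asym : Asymmetric _⊲_
⊲-asym x⊲y y⊲x = ⊲-irrefl (⊲-trans x⊲y y⊲x)

⊲⇒≢ : ∀ {x y} → x ⊲ y → x ≢ y
⊲⇒≢ x⊲x refl = ⊲-irrefl x⊲x

⊲-compare : Trichotomous _≡_ _⊲_
⊲-compare x y with ≺-compare (fromℕ x) (fromℕ y)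
... | before p = tri< (by-words p) (⊲⇒≢ (by-words p)) (⊲-asym (by-words p))
... | after p  = tri> (⊲-asym (by-words p)) (⊲⇒≢ (by-words p) ∘ sym) (by-words p)
... | equal p with fromℕ-injective {x} {y} p
...   | refl   = tri≈ ⊲-irrefl refl ⊲-irrefl

_⊲?_ : Decidable _⊲_
x ⊲? y with ⊲-compare x y
... | tri< p _ _ = yes p
... | tri≈ ¬p _ _ = no ¬p
... | tri> ¬p _ _ = no ¬p

⊲-above : ∀ x b → ∃[ z ] x ⊲ z × colour z ≡ b
⊲-above x b with above (fromℕ x) b
... | w , p , q = toℕ w , by-words (subst (fromℕ x ≺_) (sym (fromℕ-toℕ w)) p) ,
                  trans (cong parity (fromℕ-toℕ w)) q

⊲-below : ∀ x b → ∃[ z ] z ⊲ x × colour z ≡ b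
⊲-below x b with below (fromℕ x) b
... | w , p , q = toℕ w , by-words (subst (_≺ fromℕ x) (sym (fromℕ-toℕ w)) p) ,
                  trans (cong parity (fromℕ-toℕ w)) q

⊲-between : ∀ {x y} → x ⊲ y → ∀ b → ∃[ z ] x ⊲ z × z ⊲ y × colour z ≡ b
⊲-between {x} {y} (by-words x⊲y) b with between x⊲y b
... | w , p , q , r = toℕ w , by-words (subst (fromℕ x ≺_) (sym (fromℕ-toℕ w)) p) ,
                      by-words (subst (_≺ fromℕ y) (sym (fromℕ-toℕ w)) q) ,
                      trans (cong parity (fromℕ-toℕ w)) r

-- The maximum of x ∷ xs, given by its two comparison properties.
largest : ∀ x xs → ∃[ m ] (∀ {y} → m ⊲ y → All (_⊲ y) (x ∷ xs)) ×
                          (∀ {y} → All (_⊲ y) (x ∷ xs) → m ⊲ y)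
largest x []       = x , (λ m⊲y → m⊲y ∷ []) , All.head
largest x (y ∷ ys) with largest y ys
... | m , below-m , m-least with ⊲-compare x m
...   | tri< x⊲m _ _ = m , (λ m⊲z → ⊲-trans x⊲m m⊲z ∷ below-m m⊲z) , m-least ∘ All.tail
...   | tri≈ _ refl _ = m , (λ m⊲z → m⊲z ∷ below-m m⊲z) , m-least ∘ All.tail
...   | tri> _ _ m⊲x = x , (λ x⊲z → x⊲z ∷ below-m (⊲-trans m⊲x x⊲z)) , All.head

smallest : ∀ x xs → ∃[ m ] (∀ {y} → y ⊲ m → All (y ⊲_) (x ∷ xs)) ×
                           (∀ {y} → All (y ⊲_) (x ∷ xs) → y ⊲ m)
smallest x []       = x , (λ y⊲m → y⊲m ∷ []) , All.head
smallest x (y ∷ ys) with smallest y ys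
... | m , above-m , m-greatest with ⊲-compare x m
...   | tri< x⊲m _ _ = x , (λ z⊲x → z⊲x ∷ above-m (⊲-trans z⊲x x⊲m)) , All.head
...   | tri≈ _ refl _ = m , (λ z⊲m → z⊲m ∷ above-m z⊲m) , m-greatest ∘ All.tail
...   | tri> _ _ m⊲x = m , (λ z⊲m → ⊲-trans z⊲m m⊲x ∷ above-m z⊲m) , m-greatest ∘ All.tail

-- Density for finite cuts: a point of any prescribed colour lies above
-- finitely many given points and below finitely many larger ones.
fill-cut : ∀ ls hs → (∀ {l h} → l ∈ ls → h ∈ hs → l ⊲ h) → ∀ b →
           ∃[ z ] All (_⊲ z) ls × All (z ⊲_) hs × colour z ≡ b
fill-cut ls hs ls⊲hs b =
  let h , h-below , _             = smallest 0 hs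
      -- The sentinels l₀ and h₀ make the two sides of the cut nonempty:
      -- l₀ lies below all of hs, and h₀ above the maximum l of l₀ ∷ ls.
      l₀ , l₀⊲h , _               = ⊲-below h b
      l , l-above , l-least       = largest l₀ ls
      h₀ , l⊲h₀ , _               = ⊲-above l b
      h′ , h′-below , h′-greatest = smallest h₀ hs
      l⊲hs = All.tabulate λ {y} y∈hs →
        l-least (All.lookup (All.tail (h-below l₀⊲h)) y∈hs ∷
                 All.tabulate λ x∈ls → ls⊲hs x∈ls y∈hs)
      z , l⊲z , z⊲h′ , colour-z   = ⊲-between (h′-greatest (l⊲h₀ ∷ l⊲hs)) b
  in z , All.tail (l-above l⊲z) , All.tail (h′-below z⊲h′) , colour-z

------------------------------------------------------------------------
-- Back and forth

Compatible : Rel (ℕ × ℕ) 0ℓ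
Compatible (x , y) (u , v) = x ⊲ u ⇔ y ⊲ v

-- A finite order isomorphism between sets of natural numbers, given by its
-- graph, such that every point is related by P to its image.  That the
-- graph is functional and injective follows, as _⊲_ is a linear order.
record PartialIso (P : Rel ℕ 0ℓ) : Set where
  field
    pairs      : List (ℕ × ℕ)
    compatible : ∀ {p q} → p ∈ pairs → q ∈ pairs → Compatible p q
    matched    : ∀ {x y} → (x , y) ∈ pairs → P x y

open PartialIso

-- Each point can be matched with all points of some colour, hence with a
-- point in any given open interval.
Saturated : Rel ℕ 0ℓ → Set
Saturated P = ∀ x → ∃[ b ] (∀ {y} → colour y ≡ b → P x y)

module _ {P : Rel ℕ 0ℓ} where

  opposite : PartialIso P → PartialIso (flip P)
  opposite f = record
    { pairs      = List.map swap (pairs f)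
    ; compatible = λ p∈ q∈ → inverted (∈-map⁻ swap p∈) (∈-map⁻ swap q∈)
    ; matched    = λ p∈ → flipped (∈-map⁻ swap p∈)
    }
    where
    inverted : ∀ {p q} → ∃[ p′ ] p′ ∈ pairs f × p ≡ swap p′ → ∃[ q′ ] q′ ∈ pairs f × q ≡ swap q′ →
               Compatible p q
    inverted (_ , p∈ , refl) (_ , q∈ , refl) = mk⇔ (Equivalence.from e) (Equivalence.to e)
      where e = compatible f p∈ q∈
    flipped : ∀ {x y} → ∃[ p′ ] p′ ∈ pairs f × (x , y) ≡ swap p′ → P y x
    flipped (_ , p∈ , refl) = matched f p∈

  _⊑_ : PartialIso P → PartialIso P → Set
  f ⊑ g = pairs f ⊆ₗ pairs g

  forth : Saturated P → ∀ f x → ∃[ g ] f ⊑ g × ∃[ y ] (x , y) ∈ pairs g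
  forth sat f x with any? (λ p → proj₁ p ℕₚ.≟ x) (pairs f)
  ... | yes x∈dom with find x∈dom
  ...   | (_ , y) , p∈ , refl = f , id , y , p∈
  forth sat f x | no x∉dom = g , there , y , here refl
    where
    lows  = List.filter (λ p → proj₁ p ⊲? x) (pairs f)
    highs = List.filter (λ p → x ⊲? proj₁ p) (pairs f)

    separated : ∀ {l h} → l ∈ List.map proj₂ lows → h ∈ List.map proj₂ highs → l ⊲ h
    separated l∈ h∈ with ∈-map⁻ proj₂ l∈ | ∈-map⁻ proj₂ h∈
    ... | p , p∈ , refl | q , q∈ , refl
      with ∈-filter⁻ (λ p → proj₁ p ⊲? x) {xs = pairs f} p∈
         | ∈-filter⁻ (λ p → x ⊲? proj₁ p) {xs = pairs f} q∈
    ...   | p∈f , p⊲x | q∈f , x⊲q = Equivalence.to (compatible f p∈f q∈f) (⊲-trans p⊲x x⊲q)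

    b  = proj₁ (sat x)
    zs = fill-cut (List.map proj₂ lows) (List.map proj₂ highs) separated b
    y  = proj₁ zs

    low : ∀ {u v} → (u , v) ∈ pairs f → u ⊲ x → v ⊲ y
    low p∈ u⊲x = All.lookup (proj₁ (proj₂ zs))
      (∈-map⁺ proj₂ (∈-filter⁺ (λ p → proj₁ p ⊲? x) p∈ u⊲x))

    high : ∀ {u v} → (u , v) ∈ pairs f → x ⊲ u → y ⊲ v
    high p∈ x⊲u = All.lookup (proj₁ (proj₂ (proj₂ zs)))
      (∈-map⁺ proj₂ (∈-filter⁺ (λ p → x ⊲? proj₁ p) p∈ x⊲u))

    lower : ∀ {u v} → (u , v) ∈ pairs f → v ⊲ y → u ⊲ x
    lower {u} p∈ v⊲y with ⊲-compare u x
    ... | tri< u⊲x _ _ = u⊲x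
    ... | tri≈ _ u≡x _ = contradiction (lose p∈ u≡x) x∉dom
    ... | tri> _ _ x⊲u = contradiction (high p∈ x⊲u) (⊲-asym v⊲y)

    higher : ∀ {u v} → (u , v) ∈ pairs f → y ⊲ v → x ⊲ u
    higher {u} p∈ y⊲v with ⊲-compare u x
    ... | tri< u⊲x _ _ = contradiction (low p∈ u⊲x) (⊲-asym y⊲v)
    ... | tri≈ _ u≡x _ = contradiction (lose p∈ u≡x) x∉dom
    ... | tri> _ _ x⊲u = x⊲u

    g : PartialIso P
    g = record
      { pairs      = (x , y) ∷ pairs f
      ; compatible = λ where
          (here refl) (here refl) → mk⇔ (λ p → ⊥-elim (⊲-irrefl {x} p)) (λ p → ⊥-elim (⊲-irrefl {y} p))
          (here refl) (there q∈)  → mk⇔ (high q∈) (higher q∈)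
          (there p∈)  (here refl) → mk⇔ (low p∈) (lower p∈)
          (there p∈)  (there q∈)  → compatible f p∈ q∈
      ; matched    = λ where
          (here refl) → proj₂ (sat x) (proj₂ (proj₂ (proj₂ zs)))
          (there p∈)  → matched f p∈
      }

module _ {P : Rel ℕ 0ℓ} where

  back : Saturated (flip P) → ∀ (f : PartialIso P) y → ∃[ g ] f ⊑ g × ∃[ x ] (x , y) ∈ pairs g
  back sat f y with forth sat (opposite f) y
  ... | g , f⊑g , x , p∈ = opposite g , (λ q∈ → ∈-map⁺ swap (f⊑g (∈-map⁺ swap q∈))) ,
                           x , ∈-map⁺ swap p∈

-- The stages form a chain of finite isomorphisms extending f; the union of
-- the chain is a permutation, since n is in the domain and in the range from
-- stage suc n on.
module BackAndForth {P : Rel ℕ 0ℓ} (sat : Saturated P) (sat° : Saturated (flip P))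
                    (f : PartialIso P) where

  stage : ℕ → PartialIso P
  stage zero    = f
  stage (suc n) = proj₁ (back sat° (proj₁ (forth sat (stage n) n)) n)

  stage-mono : ∀ {m n} → m ℕ.≤′ n → stage m ⊑ stage n
  stage-mono ℕ.≤′-refl            p∈ = p∈
  stage-mono (ℕ.≤′-step {n} m≤n) p∈ =
    proj₁ (proj₂ (back sat° (proj₁ (forth sat (stage n) n)) n))
      (proj₁ (proj₂ (forth sat (stage n) n)) (stage-mono m≤n p∈))

  Graph : Rel ℕ 0ℓ
  Graph x y = ∃[ n ] (x , y) ∈ pairs (stage n)

  graph-compatible : ∀ {x y u v} → Graph x y → Graph u v → Compatible (x , y) (u , v)
  graph-compatible (m , p∈) (n , q∈) = compatible (stage (m ℕ.⊔ n))
    (stage-mono (ℕₚ.≤⇒≤′ (ℕₚ.m≤m⊔n m n)) p∈) (stage-mono (ℕₚ.≤⇒≤′ (ℕₚ.m≤n⊔m m n)) q∈)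

  image : ∀ x → ∃[ y ] Graph x y
  image x =
    let g , _ , y , p∈ = forth sat (stage x) x
    in y , suc x , proj₁ (proj₂ (back sat° g x)) p∈

  preimage : ∀ y → ∃[ x ] Graph x y
  preimage y =
    let x , p∈ = proj₂ (proj₂ (back sat° (proj₁ (forth sat (stage y) y)) y))
    in x , suc y , p∈

  functional : ∀ {x u y v} → Graph x y → Graph u v → x ≡ u → y ≡ v
  functional {x} {y = y} {v} p q refl with ⊲-compare y v
  ... | tri< y⊲v _ _ = contradiction (Equivalence.from (graph-compatible p q) y⊲v) (⊲-irrefl {x})
  ... | tri≈ _ y≡v _ = y≡v
  ... | tri> _ _ v⊲y = contradiction (Equivalence.from (graph-compatible q p) v⊲y) (⊲-irrefl {x})

  injective : ∀ {x u y v} → Graph x y → Graph u v → y ≡ v → x ≡ u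
  injective {x} {u} {y} p q refl with ⊲-compare x u
  ... | tri< x⊲u _ _ = contradiction (Equivalence.to (graph-compatible p q) x⊲u) (⊲-irrefl {y})
  ... | tri≈ _ x≡u _ = x≡u
  ... | tri> _ _ u⊲x = contradiction (Equivalence.to (graph-compatible q p) u⊲x) (⊲-irrefl {y})

  permutation : ℕ ↔ ℕ
  permutation = mk↔ₛ′ (proj₁ ∘ image) (proj₁ ∘ preimage)
    (λ y → functional (proj₂ (image _)) (proj₂ (preimage y)) refl)
    (λ x → injective (proj₂ (preimage _)) (proj₂ (image x)) refl)

  extension : ℕ → ℕ
  extension = proj₁ ∘ image

  monotone : ∀ x u → x ⊲ u ⇔ extension x ⊲ extension u
  monotone x u = graph-compatible (proj₂ (image x)) (proj₂ (image u))

  extension-matched : ∀ x → P x (extension x)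
  extension-matched x = let _ , n , p∈ = image x in matched (stage n) p∈

  extends : ∀ {x y} → (x , y) ∈ pairs f → extension x ≡ y
  extends p∈ = functional (proj₂ (image _)) (0 , p∈) refl

------------------------------------------------------------------------
-- The order and its expansion

orderSignature : Signature
orderSignature = record
  { FunSym       = ⊥
  ; RelSym       = ⊤
  ; funArity     = λ ()
  ; relArity     = λ _ → 2
  ; relArity-pos = λ _ → record { nonZero = tt }
  }

equivalenceSymbol : RelationSymbols
equivalenceSymbol = record
  { Index     = ⊤
  ; arity     = λ _ → 2
  ; arity-pos = λ _ → record { nonZero = tt }
  }

-- A countable dense linear order without endpoints.
rationals : Structure orderSignature ℕ
rationals = record
  { fun = λ ()
  ; rel = λ { _ (x ∷ y ∷ []) → x ⊲ y }
  }

-- The equivalence relation whose classes are the two colours.  Automorphisms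
-- may exchange the classes, as the colours themselves are not named.
twoClasses : Relations equivalenceSymbol ℕ
twoClasses = record { newRel = λ { _ (x ∷ y ∷ []) → colour x ≡ colour y } }

expansion : Structure (orderSignature ∪ₛ equivalenceSymbol) ℕ
expansion = rationals ⊕ twoClasses

------------------------------------------------------------------------
-- Both structures are Fraïssé structures

lookup-injective : {A : Set} {xs : List A} → Unique xs → ∀ i j → List.lookup xs i ≡ List.lookup xs j → i ≡ j
lookup-injective (_  ∷ _)  zero    zero    _  = refl
lookup-injective (x≢ ∷ _)  zero    (suc j) eq = contradiction eq (All.lookup x≢ (∈-lookup j))
lookup-injective (x≢ ∷ _)  (suc i) zero    eq = contradiction (sym eq) (All.lookup x≢ (∈-lookup i))
lookup-injective (_  ∷ !s) (suc i) (suc j) eq = cong suc (lookup-injective !s i j eq)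

relational⇒locallyFinite : {L : Signature} → ¬ FunSym L → (M : Structure L ℕ) → LocallyFinite M
relational⇒locallyFinite no-fun M xs = List.length ys , mk↔ₛ′ position element
  (λ i → lookup-injective (deduplicate-! ℕₚ._≟_ xs) _ i
    (sym (Anyₚ.lookup-index (member (element i)))))
  (λ s → value-injective (sym (Anyₚ.lookup-index (member s))))
  where
  ys = List.deduplicate ℕₚ._≟_ xs

  open DecMembership ℕₚ._≟_ using (_∈?_)

  generated⇒member : ∀ {x} → Generated M (_∈ xs) x → x ∈ xs
  generated⇒member (base x∈xs) = x∈xs
  generated⇒member (app f _)   = contradiction f no-fun

  member : (s : Universe M (⟨_⟩ M xs)) → value s ∈ ys
  member (x ,ʳ [ gen ]) = recompute (x ∈? ys) (∈-deduplicate⁺ ℕₚ._≟_ (generated⇒member gen))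

  position : Universe M (⟨_⟩ M xs) → Fin (List.length ys)
  position s = Any.index (member s)

  element : Fin (List.length ys) → Universe M (⟨_⟩ M xs)
  element i = List.lookup ys i ,ʳ [ base (∈-deduplicate⁻ ℕₚ._≟_ xs (∈-lookup i)) ]

  value-injective : {s t : Universe M (⟨_⟩ M xs)} → value s ≡ value t → s ≡ t
  value-injective refl = refl

everything-saturated : Saturated λ _ _ → ⊤
everything-saturated _ = true , λ _ → tt

enumerate : {A : Set} → Finite A → Σ[ xs ∈ List A ] (∀ a → a ∈ xs)
enumerate (n , A↔Fin) = List.map I.from (List.allFin n) ,
  λ a → subst (_∈ List.map I.from (List.allFin n)) (I.strictlyInverseʳ a)
                (∈-map⁺ I.from (∈-allFin (I.to a)))
  where module I = Inverse A↔Fin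

-- The finite isomorphism with the pairs (source a , target a), a ∈ as.
module _ {A : Set} (as : List A) (source target : A → ℕ)
         (mono : ∀ {a b} → a ∈ as → b ∈ as → source a ⊲ source b ⇔ target a ⊲ target b) where

  spannedBy : {P : Rel ℕ 0ℓ} → (∀ {a} → a ∈ as → P (source a) (target a)) → PartialIso P
  spannedBy {P} match = record
    { pairs      = List.map pair as
    ; compatible = λ p∈ q∈ → comp (∈-map⁻ pair p∈) (∈-map⁻ pair q∈)
    ; matched    = λ p∈ → mat (∈-map⁻ pair p∈)
    }
    where
    pair : A → ℕ × ℕ
    pair a = source a , target a
    comp : ∀ {p q} → ∃[ a ] a ∈ as × p ≡ pair a → ∃[ b ] b ∈ as × q ≡ pair b → Compatible p q
    comp (_ , a∈ , refl) (_ , b∈ , refl) = mono a∈ b∈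
    mat : ∀ {x y} → ∃[ a ] a ∈ as × (x , y) ≡ pair a → P x y
    mat (_ , a∈ , refl) = match a∈

extendToAut : (f : PartialIso λ _ _ → ⊤) →
  Σ[ g ∈ rationals ≅ rationals ] (∀ {x y} → (x , y) ∈ PartialIso.pairs f → to g x ≡ y)
extendToAut f = record
  { bijection = permutation
  ; on-fun    = λ ()
  ; on-rel    = λ { _ (x ∷ y ∷ []) → monotone x y }
  } , extends
  where open BackAndForth everything-saturated everything-saturated f

rationals-ultrahomogeneous : Ultrahomogeneous rationals
rationals-ultrahomogeneous S T finS finT φ =
  let g , ext = extendToAut (spannedBy elements value (value ∘ to φ)
                  (λ {s} {t} _ _ → on-rel φ tt (s ∷ t ∷ [])) (λ _ → tt))
  in g , λ s → ext (∈-map⁺ (λ s → value s , value (to φ s)) (complete s))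
  where
  elements = proj₁ (enumerate finS)
  complete = proj₂ (enumerate finS)

-- Points of colours a, a′ have images of colours c, c′.  If equality of colour
-- is preserved and reflected, both points undergo the same change of colour.
xor-shift : ∀ a c a′ c′ → a ≡ a′ ⇔ c ≡ c′ → c′ ≡ (a xor c) xor a′
xor-shift a c a′ c′ e with a ≟ᵇ a′
... | yes refl = trans (sym (Equivalence.to e refl)) (cancel a c)
  where
  cancel : ∀ a c → c ≡ (a xor c) xor a
  cancel false false = refl
  cancel false true  = refl
  cancel true  false = refl
  cancel true  true  = refl
... | no a≢a′ with ¬-not (a≢a′ ∘ sym) | ¬-not {c′} {c} (a≢a′ ∘ Equivalence.from e ∘ sym)
...   | refl | refl = cancel a c
  where
  cancel : ∀ a c → not c ≡ (a xor c) xor (not a)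
  cancel false false = refl
  cancel false true  = refl
  cancel true  false = refl
  cancel true  true  = refl

-- The image has the colour of the point if s is false, and the opposite
-- colour if s is true.
Shift : Bool → Rel ℕ 0ℓ
Shift s x y = colour y ≡ s xor colour x

xor-involutive : ∀ s b → s xor (s xor b) ≡ b
xor-involutive false b = refl
xor-involutive true  b = not-involutive b

shift-saturated : ∀ s → Saturated (Shift s)
shift-saturated s x = s xor colour x , id

shift-saturated° : ∀ s → Saturated (flip (Shift s))
shift-saturated° s y = s xor colour y ,
  λ eq → sym (trans (cong (s xor_) eq) (xor-involutive s (colour y)))

shift-preserves : ∀ s (h : ℕ → ℕ) → (∀ x → Shift s x (h x)) →
                  ∀ x y → colour x ≡ colour y ⇔ colour (h x) ≡ colour (h y)
shift-preserves s h shift x y = mk⇔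
  (λ eq → trans (shift x) (trans (cong (s xor_) eq) (sym (shift y))))
  (λ eq → trans (sym (xor-involutive s (colour x)))
    (trans (cong (s xor_) (trans (sym (shift x)) (trans eq (shift y))))
           (xor-involutive s (colour y))))

expansion-ultrahomogeneous : Ultrahomogeneous expansion
expansion-ultrahomogeneous S T finS finT φ = record
  { bijection = permutation
  ; on-fun    = λ ()
  ; on-rel    = λ where
      (inj₁ _) (x ∷ y ∷ []) → monotone x y
      (inj₂ _) (x ∷ y ∷ []) → shift-preserves s extension extension-matched x y
  } , λ t → extends (∈-map⁺ (λ t → value t , value (to φ t)) (complete t))
  where
  elements = proj₁ (enumerate finS)
  complete = proj₂ (enumerate finS)

  -- The first point tells whether φ exchanges the classes; the empty map
  -- extends either way.
  findShift : ∀ ts → Σ[ s ∈ Bool ] (∀ {t} → t ∈ ts → Shift s (value t) (value (to φ t)))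
  findShift []      = false , λ ()
  findShift (t ∷ _) = colour (value t) xor colour (value (to φ t)) ,
    λ {t′} _ → xor-shift _ _ (colour (value t′)) _ (on-rel φ (inj₂ tt) (t ∷ t′ ∷ []))

  s = proj₁ (findShift elements)

  open BackAndForth (shift-saturated s) (shift-saturated° s)
    (spannedBy elements value (value ∘ to φ)
      (λ {t} {t′} _ _ → on-rel φ (inj₁ tt) (t ∷ t′ ∷ [])) (proj₂ (findShift elements)))

------------------------------------------------------------------------
-- Precompactness

bit : Bool → Fin 2
bit = Inverse.from 2↔Bool

bit-injective : ∀ {b c} → bit b ≡ bit c → b ≡ c
bit-injective eq = trans (sym (unbit-bit _)) (trans (cong unbit eq) (unbit-bit _))
  where open Inverse 2↔Bool using () renaming (to to unbit; strictlyInverseˡ to unbit-bit)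

-- An expansion of A in the age is determined by the colours of the points
-- of A, that is, by one of finitely many maps from A to Fin 2.
expansion-precompact : Precompact rationals twoClasses
expansion-precompact A _ = List.map classes (List.allFin (2 ^ n)) , λ X X∈Age →
  let module e = Embedding X∈Age
      χ = bit ∘ colour ∘ e.to ∘ I.from in
  Anyₚ.map⁺ (lose (∈-allFin (funToFin χ)) λ where
    _ (a ∷ b ∷ []) → mk⇔
      (λ r → trans (decode e.to a) (trans (cong bit (Equivalence.to (e.on-rel (inj₂ tt) (a ∷ b ∷ [])) r))
                   (sym (decode e.to b))))
      (λ eq → Equivalence.from (e.on-rel (inj₂ tt) (a ∷ b ∷ []))
        (bit-injective (trans (sym (decode e.to a)) (trans eq (decode e.to b))))))
  where
  n = proj₁ (FiniteStructure.finite A)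
  module I = Inverse (proj₂ (FiniteStructure.finite A))

  classes : Fin (2 ^ n) → Relations equivalenceSymbol ∣ A ∣
  classes k = record { newRel = λ { _ (a ∷ b ∷ []) →
    finToFun {2} {n} k (I.to a) ≡ finToFun k (I.to b) } }

  decode : (h : ∣ A ∣ → ℕ) → ∀ a →
    finToFun {2} {n} (funToFin (bit ∘ colour ∘ h ∘ I.from)) (I.to a) ≡ bit (colour (h a))
  decode h a = trans (finToFun-funToFin (bit ∘ colour ∘ h ∘ I.from) (I.to a))
                     (cong (bit ∘ colour ∘ h) (I.strictlyInverseʳ a))

------------------------------------------------------------------------
-- Failure of the Ramsey property

-- The structure making i an embedding into the expansion, if i is injective.
pullback : {A : Set} → (A → ℕ) → Structure (orderSignature ∪ₛ equivalenceSymbol) A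
pullback i = record { fun = λ () ; rel = λ R xs → rel expansion R (map i xs) }

-- Two inequivalent points.
vertices : Bool → ℕ
vertices false = 0
vertices true  = 1

Point Pair : FiniteStructure (orderSignature ∪ₛ equivalenceSymbol)
Point = record { finite = 1 , ↔-sym 1↔⊤ ; structure = pullback λ _ → 0 }
Pair  = record { finite = 2 , ↔-sym 2↔Bool ; structure = pullback vertices }

point∈Age : Age expansion Point
point∈Age = record
  { to = λ _ → 0 ; injective = λ _ → refl ; on-fun = λ () ; on-rel = λ _ _ → ⇔-id _ }

pair∈Age : Age expansion Pair
pair∈Age = record
  { to        = vertices
  ; injective = λ { {false} {false} _ → refl ; {true} {true} _ → refl }
  ; on-fun    = λ ()
  ; on-rel    = λ _ _ → ⇔-id _
  }

module _ (em : ExcludedMiddle 0ℓ) (C : FiniteStructure (orderSignature ∪ₛ equivalenceSymbol))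
         (C∈Age : Age expansion C) where
  private module e = Embedding C∈Age

  -- The only point of S.
  element : (S : Copy C Point) → Universe (str C) (Copy.substructure S)
  element S = to (Copy.isomorphic S) tt

  element-unique : (S : Copy C Point) → ∀ s → s ≡ element S
  element-unique S s = sym (strictlyInverseˡ (Copy.isomorphic S) s)

  -- The colouring of the points of C by their colours in the expansion.
  pointColouring : Coloring C Point 2
  pointColouring = record
    { to   = λ S → bit (colour (e.to (value (element S))))
    ; cong = λ {S} {T} (S⊆T , _) → cong (bit ∘ colour ∘ e.to ∘ value) (element-unique T
        (value (element S) ,ʳ Irrelevant.map S⊆T (proof (element S))))
    }

  singleton : ∣ C ∣ → Copy C Point
  singleton x = record
    { substructure = record { subset = _≡ x ; closed = λ () }
    ; isomorphic   = record
      { bijection = mk↔ₛ′ (λ _ → x ,ʳ [ refl ]) (λ _ → tt)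
          (λ { (y ,ʳ [ y≡x ]) → unique y (recompute em y≡x) }) (λ _ → refl)
      ; on-fun    = λ ()
      ; on-rel    = λ where
          (inj₁ _) (_ ∷ _ ∷ []) → mk⇔ (λ p → contradiction p ⊲-irrefl)
            (λ r → contradiction (Equivalence.to (e.on-rel (inj₁ tt) (x ∷ x ∷ [])) r) ⊲-irrefl)
          (inj₂ _) (_ ∷ _ ∷ []) → mk⇔
            (λ _ → Equivalence.from (e.on-rel (inj₂ tt) (x ∷ x ∷ [])) refl) (λ _ → refl)
      }
    }
    where
    unique : ∀ y .{p} → (y≡x : y ≡ x) → (x ,ʳ [ refl ]) ≡ (y ,ʳ [ p ])
    unique y refl = refl

  no-monochromatic-pair : ¬ (Σ[ B̃ ∈ Copy C Pair ] (∀ (S T : Copy C Point) →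
    (∀ {x} → underlying S x → underlying B̃ x) → (∀ {x} → underlying T x → underlying B̃ x) →
    Func.to pointColouring S ≡ Func.to pointColouring T))
  no-monochromatic-pair (B̃ , constant) = contradiction
    (Equivalence.from (on-rel (Copy.isomorphic B̃) (inj₂ tt) (false ∷ true ∷ []))
      (Equivalence.from (e.on-rel (inj₂ tt) (vertex false ∷ vertex true ∷ []))
        (bit-injective (constant (singleton (vertex false)) (singleton (vertex true))
                             (within false) (within true)))))
    λ ()
    where
    vertex : Bool → ∣ C ∣
    vertex b = value (to (Copy.isomorphic B̃) b)

    -- Membership in a substructure is only known irrelevantly; excluded
    -- middle recovers it.
    relevant : {P : Set} → Irrelevant P → P
    relevant [ p ] = recompute em p

    within : ∀ b {x} → x ≡ vertex b → underlying B̃ x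
    within b refl = relevant (proof (to (Copy.isomorphic B̃) b))

expansion-notRamsey : ExcludedMiddle 0ℓ → ¬ RamseyProperty (Age expansion)
expansion-notRamsey em ramsey with ramsey 2 Point Pair point∈Age pair∈Age
... | C , C∈Age , arrows = no-monochromatic-pair em C C∈Age (arrows (pointColouring em C C∈Age))

------------------------------------------------------------------------
-- Ramsey's theorem

monotone-sequence : {A : Set} (_~_ : Rel A 0ℓ) → Transitive _~_ → (f : ℕ → A) →
  (∀ n → f n ~ f (suc n)) → ∀ {m n} → m < n → f m ~ f n
monotone-sequence _~_ ~-trans f step {m} m<n = go (ℕₚ.≤⇒≤′ m<n)
  where
  go : ∀ {n} → suc m ℕ.≤′ n → f m ~ f n
  go ℕ.≤′-refl        = step m
  go (ℕ.≤′-step m<n)  = ~-trans (go m<n) (step _)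

Infinite : Pred ℕ 0ℓ → Set
Infinite P = ∀ n → ∃[ m ] n < m × P m

infinite-beyond : ∀ {P} → Infinite P → ∀ a → Infinite (P ∩ (a <_))
infinite-beyond inf a n with inf (a ℕ.⊔ n)
... | m , a⊔n<m , Pm = m , ℕₚ.≤-<-trans (ℕₚ.m≤n⊔m a n) a⊔n<m ,
                       Pm , ℕₚ.≤-<-trans (ℕₚ.m≤m⊔n a n) a⊔n<m

enumerateInfinite : ∀ {P} → Infinite P →
  Σ[ e ∈ (ℕ → ℕ) ] (∀ {m n} → m < n → e m < e n) × (∀ n → P (e n))
enumerateInfinite {P} inf = e ,
  monotone-sequence _<_ ℕₚ.<-trans e (λ n → proj₁ (proj₂ (inf (e n)))) , member
  where
  e : ℕ → ℕ
  e zero    = proj₁ (inf 0)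
  e (suc n) = proj₁ (inf (e n))
  member : ∀ n → P (e n)
  member zero    = proj₂ (proj₂ (inf 0))
  member (suc n) = proj₂ (proj₂ (inf (e n)))

upperBound : ∀ k (f : Fin k → ℕ) → ∃[ N ] (∀ i → f i ≤ N)
upperBound zero    f = 0 , λ ()
upperBound (suc k) f with upperBound k (f ∘ suc)
... | N , f≤N = f zero ℕ.⊔ N , λ where
  zero    → ℕₚ.m≤m⊔n (f zero) N
  (suc i) → ℕₚ.≤-trans (f≤N i) (ℕₚ.m≤n⊔m (f zero) N)

-- The n-element subsets of ℕ are represented by increasing lists of length n.
module RamseyTheorem (em : ExcludedMiddle 0ℓ) where

  pigeonhole : ∀ {k} (f : ℕ → Fin k) → ∃[ i ] Infinite (λ n → f n ≡ i)
  pigeonhole {k} f with em {∃[ i ] Infinite (λ n → f n ≡ i)}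
  ... | yes found = found
  ... | no  none  = contradiction refl
    (proj₂ (bounded (f (suc N))) (suc N) (ℕ.s≤s (proj₂ (upperBound k last) (f (suc N)))))
    where
    bounded : ∀ i → ∃[ b ] (∀ n → b < n → f n ≢ i)
    bounded i with em {∃[ b ] (∀ n → b < n → f n ≢ i)}
    ... | yes b = b
    ... | no unbounded = contradiction (i , often) none
      where
      often : Infinite (λ n → f n ≡ i)
      often b with em {∃[ n ] b < n × f n ≡ i}
      ... | yes later = later
      ... | no never  = contradiction (b , λ n b<n eq → never (n , b<n , eq)) unbounded
    last = proj₁ ∘ bounded
    N = proj₁ (upperBound k last)

  -- All increasing lists of length n with entries in Q have the colour i.
  Homogeneous : ∀ {k} → ℕ → (List ℕ → Fin k) → Fin k → Pred ℕ 0ℓ → Set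
  Homogeneous n c i Q =
    ∀ xs → List.length xs ≡ n → AllPairs _<_ xs → All Q xs → c xs ≡ i

  -- Ramsey's theorem inside an infinite set P.
  ramsey : ∀ n {k} (c : List ℕ → Fin k) {P} → Infinite P →
    ∃[ i ] Σ[ Q ∈ Pred ℕ 0ℓ ] Infinite Q × Q ⊆ P × Homogeneous n c i Q
  ramsey zero    c {P} inf = c [] , P , inf , id , λ { [] _ _ _ → refl }
  ramsey (suc n) {k} c {P} inf = i , Q , Q-infinite , Q⊆P , homogeneous
    where
    -- The infinite set P is split into its head and an infinite set of
    -- larger elements which is homogeneous for c ∘ (head ∷_).  Iterated, this
    -- makes the colour of an increasing list of heads depend on its first
    -- entry only (the colour tint t, if that entry is the head of stage t);
    -- that dependence is removed by the pigeonhole principle.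
    module Split {P : Pred ℕ 0ℓ} (inf : Infinite P) where
      head : ℕ
      head = proj₁ (inf 0)

      head∈ : P head
      head∈ = proj₂ (proj₂ (inf 0))

      rest = ramsey n (c ∘ (head ∷_)) (infinite-beyond inf head)

    Stage : Set₁
    Stage = Σ[ P ∈ Pred ℕ 0ℓ ] Infinite P

    stage : ℕ → Stage
    stage zero    = P , inf
    stage (suc t) = let _ , Q , Q-inf , _ = Split.rest (proj₂ (stage t)) in Q , Q-inf

    set : ℕ → Pred ℕ 0ℓ
    set t = proj₁ (stage t)

    module S (t : ℕ) = Split (proj₂ (stage t))

    tint : ℕ → Fin k
    tint t = proj₁ (S.rest t)

    set-step : ∀ t → set (suc t) ⊆ (set t ∩ (S.head t <_))
    set-step t = proj₁ (proj₂ (proj₂ (proj₂ (S.rest t))))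

    set-anti : ∀ {s t} → s ℕ.≤′ t → set t ⊆ set s
    set-anti ℕ.≤′-refl       x∈ = x∈
    set-anti (ℕ.≤′-step {t} s≤t) x∈ = set-anti s≤t (proj₁ (set-step t x∈))

    head-later : ∀ {s t} → s < t → set (suc s) (S.head t)
    head-later {s} {t} s<t = set-anti (ℕₚ.≤⇒≤′ s<t) (S.head∈ t)

    head-mono : ∀ {s t} → s < t → S.head s < S.head t
    head-mono {s} s<t = proj₂ (set-step s (head-later s<t))

    head-cancel : ∀ {s t} → S.head s < S.head t → s < t
    head-cancel {s} {t} hs<ht with ℕₚ.<-cmp s t
    ... | tri< s<t _ _ = s<t
    ... | tri≈ _ refl _ = contradiction hs<ht (ℕₚ.<-irrefl refl)
    ... | tri> _ _ t<s = contradiction (head-mono {t} {s} t<s) (ℕₚ.<-asym hs<ht)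

    head-large : ∀ t → t ≤ S.head t
    head-large zero    = ℕ.z≤n
    head-large (suc t) = ℕₚ.≤-<-trans (head-large t) (head-mono {t} (ℕₚ.n<1+n t))

    i : Fin k
    i = proj₁ (pigeonhole tint)

    Q : Pred ℕ 0ℓ
    Q x = ∃[ t ] x ≡ S.head t × tint t ≡ i

    Q-infinite : Infinite Q
    Q-infinite m with proj₂ (pigeonhole tint) m
    ... | t , m<t , eq = S.head t , ℕₚ.<-≤-trans m<t (head-large t) , t , refl , eq

    Q⊆P : Q ⊆ P
    Q⊆P (t , refl , _) = set-anti {0} {t} (ℕₚ.≤⇒≤′ ℕ.z≤n) (S.head∈ t)

    homogeneous : Homogeneous (suc n) c i Q
    homogeneous (_ ∷ xs) len (x< ∷ incr) ((t , refl , eq) ∷ xs∈Q) = trans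
      (proj₂ (proj₂ (proj₂ (proj₂ (S.rest t)))) xs (ℕₚ.suc-injective len) incr
        (All.zipWith later (x< , xs∈Q)))
      eq
      where
      later : ∀ {y} → S.head t < y × Q y → set (suc t) y
      later (x<y , s , refl , _) = head-later {t} {s} (head-cancel x<y)

  -- The homogeneous set of ramsey, listed in increasing order by e.
  ramsey-sequence : ∀ n {k} (c : List ℕ → Fin k) →
    ∃[ i ] Σ[ e ∈ (ℕ → ℕ) ] (∀ {m m′} → m < m′ → e m < e m′) ×
      (∀ xs → List.length xs ≡ n → AllPairs _<_ xs → c (List.map e xs) ≡ i)
  ramsey-sequence n c with ramsey n c {λ _ → ⊤} (λ m → suc m , ℕₚ.n<1+n m , tt)
  ... | i , Q , inf , _ , hom with enumerateInfinite inf
  ...   | e , mono , e∈Q = i , e , mono , λ xs len incr → hom (List.map e xs)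
    (trans (Listₚ.length-map e xs) len)
    (AllPairsₚ.map⁺ (AllPairs.map mono incr))
    (Allₚ.map⁺ (All.universal e∈Q xs))

------------------------------------------------------------------------
-- Ramsey's theorem for finite subsets of the rationals

-- Insertion into an increasing list, omitting duplicates.
insert : ℕ → List ℕ → List ℕ
insert x []       = x ∷ []
insert x (y ∷ ys) with ⊲-compare x y
... | tri< _ _ _ = x ∷ y ∷ ys
... | tri≈ _ _ _ = y ∷ ys
... | tri> _ _ _ = y ∷ insert x ys

sort : List ℕ → List ℕ
sort = List.foldr insert []

insert-∈ˡ : ∀ x ys → x ∈ insert x ys
insert-∈ˡ x []       = here refl
insert-∈ˡ x (y ∷ ys) with ⊲-compare x y
... | tri< _ _ _   = here refl
... | tri≈ _ x≡y _ = here x≡y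
... | tri> _ _ _   = there (insert-∈ˡ x ys)

insert-∈ʳ : ∀ x {z} ys → z ∈ ys → z ∈ insert x ys
insert-∈ʳ x (y ∷ ys) z∈ with ⊲-compare x y
insert-∈ʳ x (y ∷ ys) z∈         | tri< _ _ _ = there z∈
insert-∈ʳ x (y ∷ ys) z∈         | tri≈ _ _ _ = z∈
insert-∈ʳ x (y ∷ ys) (here eq)  | tri> _ _ _ = here eq
insert-∈ʳ x (y ∷ ys) (there z∈) | tri> _ _ _ = there (insert-∈ʳ x ys z∈)

∈-sort : ∀ {z} xs → z ∈ xs → z ∈ sort xs
∈-sort (x ∷ xs) (here refl) = insert-∈ˡ x (sort xs)
∈-sort (x ∷ xs) (there z∈)  = insert-∈ʳ x (sort xs) (∈-sort xs z∈)

insert-all : ∀ {P : Pred ℕ 0ℓ} {x} ys → P x → All P ys → All P (insert x ys)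
insert-all []       Px Pys = Px ∷ []
insert-all {x = x} (y ∷ ys) Px Pys with ⊲-compare x y
... | tri< _ _ _ = Px ∷ Pys
... | tri≈ _ _ _ = Pys
... | tri> _ _ _ = All.head Pys ∷ insert-all ys Px (All.tail Pys)

insert-sorted : ∀ x {ys} → AllPairs _⊲_ ys → AllPairs _⊲_ (insert x ys)
insert-sorted x []                 = [] ∷ []
insert-sorted x (_∷_ {y} {ys} y⊲ sorted) with ⊲-compare x y
... | tri< x⊲y _ _ = (x⊲y ∷ All.map (⊲-trans x⊲y) y⊲) ∷ y⊲ ∷ sorted
... | tri≈ _ _ _   = y⊲ ∷ sorted
... | tri> _ _ y⊲x = insert-all ys y⊲x y⊲ ∷ insert-sorted x sorted

sort-sorted : ∀ xs → AllPairs _⊲_ (sort xs)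
sort-sorted []       = []
sort-sorted (x ∷ xs) = insert-sorted x (sort-sorted xs)

-- The number of elements of the list below x.
rank : List ℕ → ℕ → ℕ
rank []       x = 0
rank (b ∷ bs) x with b ⊲? x
... | yes _ = suc (rank bs x)
... | no  _ = rank bs x

rank-≤ : ∀ bs {x y} → x ⊲ y → rank bs x ≤ rank bs y
rank-≤ []       x⊲y = ℕ.z≤n
rank-≤ (b ∷ bs) {x} {y} x⊲y with b ⊲? x | b ⊲? y
... | yes b⊲x | yes _  = ℕ.s≤s (rank-≤ bs x⊲y)
... | yes b⊲x | no b⋪y = contradiction (⊲-trans b⊲x x⊲y) b⋪y
... | no _    | yes _  = ℕₚ.m≤n⇒m≤1+n (rank-≤ bs x⊲y)
... | no _    | no _   = rank-≤ bs x⊲y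

rank-< : ∀ bs {x y} → x ∈ bs → x ⊲ y → rank bs x < rank bs y
rank-< (b ∷ bs) {x} {y} x∈ x⊲y with b ⊲? x | b ⊲? y | x∈
... | yes b⊲x | no b⋪y | _         = contradiction (⊲-trans b⊲x x⊲y) b⋪y
... | no _    | yes _  | _         = ℕ.s≤s (rank-≤ bs x⊲y)
... | yes b⊲x | yes _  | here refl = contradiction b⊲x ⊲-irrefl
... | yes b⊲x | yes _  | there x∈′ = ℕ.s≤s (rank-< bs x∈′ x⊲y)
... | no _    | no b⋪y | here refl = contradiction x⊲y b⋪y
... | no _    | no _   | there x∈′ = rank-< bs x∈′ x⊲y

-- An increasing ω-sequence of rationals.
ascending : ℕ → ℕ
ascending zero    = 0
ascending (suc n) = proj₁ (⊲-above (ascending n) true)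

ascending-mono : ∀ {m n} → m < n → ascending m ⊲ ascending n
ascending-mono = monotone-sequence _⊲_ ⊲-trans ascending
  (λ n → proj₁ (proj₂ (⊲-above (ascending n) true)))

module G = Group (Aut rationals)

increasing⇒aut : ∀ bs (f : ℕ → ℕ) → (∀ {x y} → x ∈ bs → y ∈ bs → x ⊲ y → f x ⊲ f y) →
  Σ[ g ∈ G.Carrier ] (∀ {x} → x ∈ bs → to g x ≡ f x)
increasing⇒aut bs f mono =
  let g , ext = extendToAut (spannedBy bs id f
                  (λ x∈ y∈ → mk⇔ (mono x∈ y∈) (cancel x∈ y∈)) (λ _ → tt))
  in g , λ x∈ → ext (∈-map⁺ (λ x → x , f x) x∈)
  where
  cancel : ∀ {x y} → x ∈ bs → y ∈ bs → f x ⊲ f y → x ⊲ y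
  cancel {x} {y} x∈ y∈ fx⊲fy with ⊲-compare x y
  ... | tri< x⊲y _ _  = x⊲y
  ... | tri≈ _ refl _ = contradiction fx⊲fy ⊲-irrefl
  ... | tri> _ _ y⊲x  = contradiction (mono y∈ x∈ y⊲x) (⊲-asym fx⊲fy)

-- Lists of rationals of the form g⁻¹ as are the copies of as.  The finite
-- set bs can be moved by t = h⁻¹ into a homogeneous subsequence of the
-- ascending sequence; then all copies of as inside t bs have the same colour.
ramsey-copies : ExcludedMiddle 0ℓ → ∀ as → AllPairs _⊲_ as → ∀ bs {k} (χ : List ℕ → Fin k) →
  Σ[ h ∈ G.Carrier ] ∃[ i ] (∀ g → (∀ {a} → a ∈ as → from g a ∈ bs) →
    χ (List.map (from (g G.∙ h)) as) ≡ i)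
ramsey-copies em as sorted bs χ with RamseyTheorem.ramsey-sequence em (List.length as) (χ ∘ List.map ascending)
... | i , e , e-mono , homogeneous = (t G.⁻¹) , i , λ g g⁻¹as⊆bs →
  trans (cong χ (image g g⁻¹as⊆bs))
    (homogeneous (List.map (rank bs ∘ from g) as) (Listₚ.length-map _ as)
      (AllPairsₚ.map⁺ (increasing g g⁻¹as⊆bs id sorted)))
  where
  aut = increasing⇒aut bs (ascending ∘ e ∘ rank bs)
          (λ x∈ _ x⊲y → ascending-mono (e-mono (rank-< bs x∈ x⊲y)))
  t = proj₁ aut

  from-mono : ∀ (g : G.Carrier) {x y} → x ⊲ y → from g x ⊲ from g y
  from-mono g {x} {y} = Equivalence.to (on-rel (g G.⁻¹) tt (x ∷ y ∷ []))

  image : ∀ g → (∀ {a} → a ∈ as → from g a ∈ bs) →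
    List.map (from (g G.∙ (t G.⁻¹))) as ≡
    List.map ascending (List.map e (List.map (rank bs ∘ from g) as))
  image g g⁻¹as⊆bs = trans (map-cong∈ (λ a∈ → proj₂ aut (g⁻¹as⊆bs a∈)))
    (trans (Listₚ.map-∘ as) (Listₚ.map-∘ _))
    where
    map-cong∈ : ∀ {f f′ : ℕ → ℕ} {xs} → (∀ {x} → x ∈ xs → f x ≡ f′ x) → List.map f xs ≡ List.map f′ xs
    map-cong∈ eq = Listₚ.map-cong-local (All.tabulate eq)

  increasing : ∀ g → (∀ {a} → a ∈ as → from g a ∈ bs) → ∀ {xs} → (∀ {x} → x ∈ xs → x ∈ as) →
    AllPairs _⊲_ xs → AllPairs (λ x y → rank bs (from g x) < rank bs (from g y)) xs
  increasing g inc xs⊆as []            = []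
  increasing g inc xs⊆as (x⊲ ∷ sorted) =
    All.map (λ x⊲y → rank-< bs (inc (xs⊆as (here refl))) (from-mono g x⊲y)) x⊲ ∷
    increasing g inc (xs⊆as ∘ there) sorted

------------------------------------------------------------------------
-- Extreme amenability of the automorphism group of the rationals

module _ (em : ∀ {ℓ} → ExcludedMiddle ℓ) {b p : Level} (Y : Flow rationals b p)
         (hausdorff : Hausdorff (Flow.space Y)) (compact : Compact (Flow.space Y)) where
  private module Y = Flow Y
  open Y using (_·_)

  Fixed : Pred Y.Carrier b
  Fixed y = ∀ g → (g · y) Y.≈ y

  -- A witness that y is not fixed, robust under the pointwise stabiliser of
  -- a finite set: mover takes the neighbourhood outer of y off itself, and the
  -- stabiliser of support takes the smaller neighbourhood inner into outer.
  record Displaced (y : Y.Carrier) : Set (lsuc b ⊔ p) where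
    field
      mover      : G.Carrier
      support    : List ℕ
      outer      : Pred Y.Carrier b
      inner      : Pred Y.Carrier b
      outer-open : Y.IsOpen outer
      inner-open : Y.IsOpen inner
      y∈inner    : inner y
      disjoint   : ∀ {z} → outer z → ¬ outer (mover · z)
      stable     : ∀ h → (∀ {x} → x ∈ support → to G.ε x ≡ to h x) →
                   ∀ {z} → inner z → outer (h · z)

  open Displaced

  moved : (¬ (∃[ y ] Fixed y)) → ∀ y → ∃[ g ] ¬ ((g · y) Y.≈ y)
  moved none y with em {P = ∃[ g ] ¬ ((g · y) Y.≈ y)}
  ... | yes moves = moves
  ... | no  still = contradiction (y , fixed) none
    where
    fixed : Fixed y
    fixed g with em {P = (g · y) Y.≈ y}
    ... | yes eq = eq
    ... | no neq = contradiction (g , neq) still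

  displace : (¬ (∃[ y ] Fixed y)) → ∀ y → Displaced y
  displace none y =
    let g , gy≉y = moved none y
        U , V , U-open , V-open , y∈U , gy∈V , U∩V=∅ =
          hausdorff y (g · y) (λ eq → gy≉y (Y.sym eq))
        V₁ , W₁ , _ , W₁-open , g∈V₁ , y∈W₁ , V₁W₁⊆V = Y.continuous g y V V-open gy∈V
        W-open = Y.open-∩ U-open W₁-open
        V₂ , W₂ , V₂-open , W₂-open , ε∈V₂ , y∈W₂ , V₂W₂⊆W = Y.continuous G.ε y _ W-open
          (Y.open-respects W-open (Y.sym (Y.·-identity y)) (y∈U , y∈W₁))
        xs , xs-support = V₂-open G.ε ε∈V₂
    in record
      { mover      = g
      ; support    = xs
      ; outer-open = W-open
      ; inner-open = W₂-open
      ; y∈inner    = y∈W₂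
      ; disjoint   = λ (_ , z∈W₁) (gz∈U , _) → U∩V=∅ _ gz∈U (V₁W₁⊆V g∈V₁ z∈W₁)
      ; stable     = λ h fix z∈W₂ → V₂W₂⊆W (xs-support h fix) z∈W₂
      }

  -- Finitely many neighbourhoods inner (D j) of displaced points cannot cover
  -- the flow.
  module FiniteCover (D : ∀ y → Displaced y) (is : List Y.Carrier)
                     (cover : ∀ y → Any (λ j → inner (D j) y) is) where

    as : List ℕ
    as = sort (concatMap (support ∘ D) is)

    translates : Y.Carrier → List ℕ
    translates y = List.map (from (mover (D y))) as

    bs : List ℕ
    bs = as ++ concatMap translates is

    piece : Y.Carrier → Fin (List.length is)
    piece y = Any.index (cover y)

    -- A copy v = h⁻¹ as is coloured by the index of a piece of the cover that
    -- contains h · y₀, where y₀ is the base point.  The choice of h does not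
    -- matter up to passing from inner to outer, by choose-outer below.
    choose : ∀ v → Dec (Σ[ h ∈ G.Carrier ] List.map (from h) as ≡ v) → Fin (List.length is)
    choose v (yes (h , _)) = piece (h · Y.nonempty)
    -- The default value is never used: only copies of as are considered.
    choose v (no _)        = piece Y.nonempty

    χ : List ℕ → Fin (List.length is)
    χ v = choose v em

    fixes-as : ∀ h h₀ → List.map (from h₀) as ≡ List.map (from h) as →
      ∀ {a} → a ∈ as → to (h G.∙ (h₀ G.⁻¹)) a ≡ a
    fixes-as h h₀ agreement a∈ =
      trans (cong (to h) (All.lookup (agree as agreement) a∈)) (strictlyInverseˡ h _)
      where
      agree : ∀ as → List.map (from h₀) as ≡ List.map (from h) as → All (λ a → from h₀ a ≡ from h a) as
      agree []       _  = []
      agree (a ∷ as) eq = Listₚ.∷-injectiveˡ eq ∷ agree as (Listₚ.∷-injectiveʳ eq)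

    support⊆as : ∀ k {x} → x ∈ support (D (List.lookup is k)) → x ∈ as
    support⊆as k x∈ = ∈-sort (concatMap (support ∘ D) is)
      (∈-concatMap⁺ (support ∘ D) {xs = is} (lose (∈-lookup k) x∈))

    choose-outer : ∀ h (h? : Dec (Σ[ h₀ ∈ G.Carrier ] List.map (from h₀) as ≡ List.map (from h) as)) →
      outer (D (List.lookup is (choose _ h?))) (h · Y.nonempty)
    choose-outer h (no none)              = contradiction (h , refl) none
    choose-outer h (yes (h₀ , agreement)) = Y.open-respects (outer-open D₀)
      (Y.trans (Y.sym (Y.·-assoc s h₀ Y.nonempty))
        (Y.·-cong {s G.∙ h₀} {h} (λ x → cong (to h) (strictlyInverseʳ h₀ x)) Y.refl))
      (stable D₀ s (λ x∈ → sym (fixes-as h h₀ agreement (support⊆as k x∈)))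
        (Anyₚ.lookup-index (cover (h₀ · Y.nonempty))))
      where
      s = h G.∙ (h₀ G.⁻¹)
      k = piece (h₀ · Y.nonempty)
      D₀ = D (List.lookup is k)

    in-outer : ∀ {i} f → χ (List.map (from f) as) ≡ i → outer (D (List.lookup is i)) (f · Y.nonempty)
    in-outer f refl = choose-outer f em

    -- Otherwise h · y₀ and its translate by the mover are both in the i-th
    -- outer set.
    displacement-fails : ∀ i h (let g = mover (D (List.lookup is i))) →
      χ (List.map (from h) as) ≡ i → ¬ (χ (List.map (from (g G.∙ h)) as) ≡ i)
    displacement-fails i h eq eq′ = disjoint Dᵢ (in-outer h eq)
      (Y.open-respects (outer-open Dᵢ) (Y.·-assoc (mover Dᵢ) h Y.nonempty)
        (in-outer (mover Dᵢ G.∙ h) eq′))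
      where Dᵢ = D (List.lookup is i)

    translate⊆bs : ∀ i {a} → a ∈ as → from (mover (D (List.lookup is i))) a ∈ bs
    translate⊆bs i a∈ = ∈-++⁺ʳ as (∈-concatMap⁺ translates {xs = is}
      (lose (∈-lookup i) (∈-map⁺ (from (mover (D (List.lookup is i)))) a∈)))

    impossible : ⊥
    impossible = displacement-fails i h (homogeneous G.ε ∈-++⁺ˡ)
      (homogeneous (mover (D (List.lookup is i))) (translate⊆bs i))
      where
      found = ramsey-copies em as (sort-sorted (concatMap (support ∘ D) is)) bs χ
      h = proj₁ found
      i = proj₁ (proj₂ found)
      homogeneous = proj₂ (proj₂ found)

  fixedPoint : ∃[ y ] Fixed y
  fixedPoint with em {P = ∃[ y ] Fixed y}
  ... | yes found = found
  ... | no  none  =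
    let D = displace none
        is , cover = compact (λ y → inner (D y)) (λ y → inner-open (D y)) (λ y → y , y∈inner (D y))
    in ⊥-elim (FiniteCover.impossible D is cover)

  minimal⇒trivial : Minimal rationals Y → ∃[ y ] ∀ z → y Y.≈ z
  minimal⇒trivial minimal = y , y≈
    where
    y = proj₁ fixedPoint
    y≈ : ∀ z → y Y.≈ z
    y≈ z with em {P = y Y.≈ z}
    ... | yes y≈z = y≈z
    ... | no  y≉z =
      let U , V , U-open , V-open , y∈U , z∈V , U∩V=∅ = hausdorff y z y≉z
          g , gy∈V = minimal y V V-open (z , z∈V)
      in contradiction (Y.open-respects V-open (proj₂ fixedPoint g) gy∈V) (U∩V=∅ y y∈U)

------------------------------------------------------------------------
-- Universality

-- Any flow maps onto every compact Hausdorff minimal flow, by a constant map.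
everyFlow-universal : (∀ {ℓ} → ExcludedMiddle ℓ) → {a o : Level}
  (X : Flow rationals a o) → IsUniversal rationals X
everyFlow-universal em X Y hausdorff compact minimal = record
  { π           = λ _ → y
  ; π-cong      = λ _ → Y.refl
  ; continuous  = λ _ V _ y∈V → (λ _ → Polymorphic.⊤) , X.open-univ , _ , λ _ → y∈V
  ; surjective  = λ z → X.nonempty , y≈ z
  ; equivariant = λ g _ → y≈ (g Y.· y)
  }
  where
  module X = Flow X
  module Y = Flow Y
  trivial = minimal⇒trivial em Y hausdorff compact minimal
  y  = proj₁ trivial
  y≈ = proj₂ trivial

mainTheorem5 : (∀ {ℓ} → ExcludedMiddle ℓ) →
    Σω[ L ∈ Signature ] Σω[ E ∈ RelationSymbols ]
    Σω[ F ∈ Structure L ℕ ] Σω[ R ∈ Relations E ℕ ]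
    ( IsCountable L × Countable (Index E)
    × IsFraïssé F × IsFraïssé (F ⊕ R) × Precompact F R
    × ¬ RamseyProperty (Age (F ⊕ R)) )
    ×ω IsUniversal F (completionFlow F R)
mainTheorem5 em = orderSignature ,ω (equivalenceSymbol ,ω (rationals ,ω (twoClasses ,ω (
  ( (mk↣ {to = λ ()} (λ { {()} }) , singleton-countable)
  , singleton-countable
  , (relational⇒locallyFinite (λ ()) rationals , rationals-ultrahomogeneous)
  , (relational⇒locallyFinite (λ ()) expansion , expansion-ultrahomogeneous)
  , expansion-precompact
  , expansion-notRamsey em ) ,ω
  everyFlow-universal em (completionFlow rationals twoClasses)))))
  where
  singleton-countable : Countable ⊤
  singleton-countable = mk↣ {to = λ _ → 0} λ _ → refl
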